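{- There are absolute constants $p_0,\epsilon_0\in(0,1)$ such that for any $p\le p_0$ and $\epsilon\le\epsilon_0$, finding a $(1-\epsilon)$-approximate maximum matching of a bipartite stochastic graph $G_p$ requires querying a subgraph of maximum degree $\Omega\!\left(\frac{1}{\epsilon p}\right)$.
   Context: $G_p$ is the random subgraph of a given graph $G$ containing each edge independently with probability $p$. An algorithm non-adaptively chooses a subgraph $Q$ of $G$ to query, learns which edges of $Q$ are in $G_p$, and outputs a matching $M\subseteq Q\cap E(G_p)$; it is $(1-\epsilon)$-approximate if $\mathbb{E}|M|\ge(1-\epsilon)\mathbb{E}[\mu(G_p)]$, where $\mu$ denotes maximum matching size. The statement asserts that there exist bipartite graphs $G$ for which every such algorithm must query a subgraph $Q$ of maximum degree $\Omega(1/(\epsilon p))$.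
   Formalization: The probability p and the accuracy ε range over rational numbers only, and the constants are rational; algorithms are taken as deterministic (randomized ones with a worst-case degree bound follow by averaging). -}

module Defs where

open import Data.Bool using (Bool; true; false; if_then_else_; _∧_; not)
open import Data.Nat as ℕ using (ℕ; zero; suc)
open import Data.Fin as Fin using (Fin)
open import Data.Fin.Subset using (Subset; _∈_; _⊆_; _∩_; ∣_∣)
open import Data.Vec as Vec using (Vec; []; _∷_; tabulate; lookup)
open import Data.List as List using (List; []; _∷_; _++_; allFin)
open import Data.Product using (_×_; proj₁; proj₂)
open import Data.Integer using (+_)
open import Data.Rational using (ℚ; _+_; _*_; _-_; 0ℚ; 1ℚ; _/_)
open import Function.Definitions using (Injective)
open import Relation.Binary.PropositionalEquality using (_≡_; _≢_)
open import Relation.Nullary.Decidable using (⌊_⌋)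

record BipGraph : Set where
  field
    left right m : ℕ
    edge : Fin m → Fin left × Fin right
    simple : Injective _≡_ _≡_ edge
open BipGraph public

EdgeSet : BipGraph → Set
EdgeSet G = Subset (m G)

ℕ→ℚ : ℕ → ℚ
ℕ→ℚ n = (+ n) / 1

allSubsets : (k : ℕ) → List (Subset k)
allSubsets zero = [] ∷ []
allSubsets (suc k) =
  List.map (true ∷_) (allSubsets k) ++ List.map (false ∷_) (allSubsets k)

allᵇ : (k : ℕ) → (Fin k → Bool) → Bool
allᵇ k f = List.foldr _∧_ true (List.map f (allFin k))

isMatchingᵇ : (G : BipGraph) → EdgeSet G → Bool
isMatchingᵇ G M = allᵇ (m G) λ i → allᵇ (m G) λ j →
  if lookup M i ∧ lookup M j ∧ not ⌊ i Fin.≟ j ⌋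
  then not ⌊ proj₁ (edge G i) Fin.≟ proj₁ (edge G j) ⌋
       ∧ not ⌊ proj₂ (edge G i) Fin.≟ proj₂ (edge G j) ⌋
  else true

IsMatching : (G : BipGraph) → EdgeSet G → Set
IsMatching G M = ∀ i j → i ∈ M → j ∈ M → i ≢ j →
  (proj₁ (edge G i) ≢ proj₁ (edge G j)) × (proj₂ (edge G i) ≢ proj₂ (edge G j))

⊆ᵇ : ∀ {k} → Subset k → Subset k → Bool
⊆ᵇ {k} A B = allᵇ k λ i → if lookup A i then lookup B i else true

μ : (G : BipGraph) → EdgeSet G → ℕ
μ G S = List.foldr ℕ._⊔_ 0
  (List.map (λ M → if ⊆ᵇ M S ∧ isMatchingᵇ G M then ∣ M ∣ else 0)
            (allSubsets (m G)))

prob : (p : ℚ) (G : BipGraph) → EdgeSet G → ℚ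
prob p G S = List.foldr _*_ 1ℚ
  (List.map (λ i → if lookup S i then p else (1ℚ - p)) (allFin (m G)))

𝔼 : (p : ℚ) (G : BipGraph) → (EdgeSet G → ℚ) → ℚ
𝔼 p G f = List.foldr _+_ 0ℚ
  (List.map (λ S → prob p G S * f S) (allSubsets (m G)))

degL : (G : BipGraph) → EdgeSet G → Fin (left G) → ℕ
degL G Q u = ∣ Q ∩ tabulate (λ i → ⌊ proj₁ (edge G i) Fin.≟ u ⌋) ∣

degR : (G : BipGraph) → EdgeSet G → Fin (right G) → ℕ
degR G Q v = ∣ Q ∩ tabulate (λ i → ⌊ proj₂ (edge G i) Fin.≟ v ⌋) ∣

maxDeg : (G : BipGraph) → EdgeSet G → ℕ
maxDeg G Q =
  List.foldr ℕ._⊔_ 0 (List.map (degL G Q) (allFin (left G)))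
  ℕ.⊔ List.foldr ℕ._⊔_ 0 (List.map (degR G Q) (allFin (right G)))

-- A non-adaptive algorithm: query set Q, and a rule producing a matching
-- from the observed edges Q ∩ E(G_p).
record Algorithm (G : BipGraph) : Set where
  field
    query : EdgeSet G
    output : EdgeSet G → EdgeSet G
    sound : ∀ S → output (query ∩ S) ⊆ (query ∩ S)
    matching : ∀ S → IsMatching G (output (query ∩ S))
open Algorithm public

Approx : (p ε : ℚ) (G : BipGraph) → Algorithm G → Set
Approx p ε G A =
  (1ℚ - ε) * 𝔼 p G (λ S → ℕ→ℚ (μ G S))
    Data.Rational.≤ 𝔼 p G (λ S → ℕ→ℚ ∣ output A (query A ∩ S) ∣)

{-# OPTIONS --safe #-}
module Submission where

-- In the hard graph every left vertex v_j (j < n) has d private leaves and is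
-- joined to all of k common right vertices u by "core" edges.  A core edge at
-- v_j enlarges a matching only if all leaf edges of v_j are missing from G_p,
-- which has probability q = (1 - p)^d, so with a query set of maximum degree D
-- the output has expected size at most n (1 - q) + k D p q.  In G_p itself the
-- useful core edges sharing no end with another useful core edge give a
-- matching of expected size at least n (1 - q) + n k p q (1 - k p - n p q).
-- With 32 ε ≤ q ≤ 64 ε and k p, n p q in [1/8, 1/4], the last summand is at
-- least 2 ε n, while a (1 - ε)-approximation can afford to lose only ε n, and
-- this forces D = Ω(1 / (ε p)).
open import Defs
open import Algebra.Bundles using (CommutativeRing)
open import Data.Bool using (Bool; true; false; if_then_else_; _∧_; not)
import Data.Bool as Bool
open import Data.Bool.Properties using (∧-identityʳ; ¬-not)
open import Data.Fin using (Fin; zero; suc; _↑ˡ_; _↑ʳ_; combine; remQuot; splitAt)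
import Data.Fin as Fin
import Data.Fin.Properties as FinP
open import Data.Fin.Subset using (Subset; ∣_∣; _⊆_; _∩_)
open import Data.Fin.Subset.Properties using (x∈p∩q⁻)
import Data.Integer as ℤ
import Data.Integer.Properties as ℤP
import Data.List as List
import Data.List.Membership.Propositional as L∈
import Data.List.Membership.Propositional.Properties as L∈P
import Data.List.Properties as ListP
open import Data.List.Relation.Unary.Any using (here; there)
open import Data.Maybe using (Maybe; just; nothing)
import Data.Maybe.Properties as MaybeP
open import Data.Nat as ℕ using (ℕ; zero; suc)
import Data.Nat.Properties as ℕP
open import Data.Product using (Σ; ∃; _×_; _,_; proj₁; proj₂)
open import Data.Product.Properties using (,-injectiveˡ; ,-injectiveʳ)
open import Data.Rational using (ℚ; mkℚ; *<*; _≤_; _<_; _+_; _*_; _-_; -_; 0ℚ; 1ℚ; _/_; toℚᵘ; positive; nonNegative)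
open import Data.Rational.Properties hiding (_≤?_; _<?_; _≟_)
import Data.Rational.Properties as ℚP
open import Data.Rational.Solver
import Data.Rational.Unnormalised as ℚᵘ
import Data.Rational.Unnormalised.Properties as ℚᵘP
open import Data.Sum using (_⊎_; inj₁; inj₂; [_,_]′)
open import Data.Vec using ([]; _∷_; lookup; tabulate)
import Data.Vec.Properties as VecP
open import Function using (_∘_)
open import Relation.Binary.PropositionalEquality
  using (_≡_; _≢_; refl; sym; trans; cong; cong₂; subst; subst₂; module ≡-Reasoning)
open import Relation.Nullary using (¬_; Dec; yes; no)
open import Relation.Nullary.Decidable using (⌊_⌋; ¬?; _×-dec_; _→-dec_; from-yes; from-no)
open import Relation.Nullary.Negation using (contradiction)
open import Relation.Unary using (Pred; Decidable; ∁) renaming (_⊆_ to _⊆ᴾ_)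

open import Algebra.Properties.Monoid.Sum *-1-monoid
  using () renaming (sum to prod)
open import Algebra.Properties.Semiring.Sum (CommutativeRing.semiring +-*-commutativeRing)
  using (sum; sum-cong-≗; ∑-distrib-+; ∑-comm; *-distribˡ-sum; *-distribʳ-sum)
open +-*-Solver using (solve; _:+_; _:*_; _:-_; :-_; _:=_; con)

-- Ordered-field arithmetic

-- The bound is essentially n: a core edge is useful with probability p q, so a common vertex can
-- carry about 1 / (p q) core edges before its useful ones begin to collide, and the estimates
-- amount to D ≥ n / 4. A smaller q therefore gives a stronger bound, but all core edges together
-- raise the expectation above n (1 - q) by at most n q, which has to exceed the permitted loss of
-- up to ε n; hence q of order ε. The windows [1/8, 1/4] and [32 ε, 64 ε] span a factor of two
-- because n, k and d are integers: a step in k or n changes k p or n p q by at most 1/8, and one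
-- more leaf at most halves q. Nonlinear inequalities are proved by certificates: the difference of
-- the two sides is written as a visibly nonnegative expression, and the ring solver checks the
-- identity.

≤-witness : ∀ {a b} c → 0ℚ ≤ c → b ≡ a + c → a ≤ b
≤-witness {a} c 0≤c refl = subst (_≤ a + c) (+-identityʳ a) (+-monoʳ-≤ a 0≤c)

p≤q⇒0≤q-p : ∀ {p q} → p ≤ q → 0ℚ ≤ q - p
p≤q⇒0≤q-p {p} {q} p≤q = subst (_≤ q - p) (+-inverseʳ p) (+-monoˡ-≤ (- p) p≤q)

*-monoˡ-≤ : ∀ {p q r} → 0ℚ ≤ r → p ≤ q → r * p ≤ r * q
*-monoˡ-≤ {r = r} 0≤r = *-monoˡ-≤-nonNeg r {{nonNegative 0≤r}}

*-monoʳ-≤ : ∀ {p q r} → 0ℚ ≤ r → p ≤ q → p * r ≤ q * r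
*-monoʳ-≤ {r = r} 0≤r = *-monoʳ-≤-nonNeg r {{nonNegative 0≤r}}

0≤-+ : ∀ {p q} → 0ℚ ≤ p → 0ℚ ≤ q → 0ℚ ≤ p + q
0≤-+ = +-mono-≤

0≤-* : ∀ {p q} → 0ℚ ≤ p → 0ℚ ≤ q → 0ℚ ≤ p * q
0≤-* {p} {q} 0≤p 0≤q = subst (_≤ p * q) (*-zeroʳ p) (*-monoˡ-≤ 0≤p 0≤q)

0<-* : ∀ {p q} → 0ℚ < p → 0ℚ < q → 0ℚ < p * q
0<-* {p} {q} 0<p 0<q = positive⁻¹ (p * q) {{pos*pos⇒pos p {{positive 0<p}} q {{positive 0<q}}}}

0≤1 : 0ℚ ≤ 1ℚ
0≤1 = nonNegative⁻¹ 1ℚ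

ℕ→ℚ-suc : ∀ n → ℕ→ℚ (suc n) ≡ 1ℚ + ℕ→ℚ n
ℕ→ℚ-suc n = toℚᵘ-injective (begin
  toℚᵘ (ℕ→ℚ (suc n))              ≈⟨ toℚᵘ-fromℚᵘ (ℚᵘ.mkℚᵘ (ℤ.+ suc n) 0) ⟩
  ℚᵘ.mkℚᵘ (ℤ.+ suc n) 0             ≈⟨ ℚᵘ.*≡* (cong (ℤ._* (ℤ.+ 1)) (sym (cong (ℤ._+_ (ℤ.+ 1)) (ℤP.*-identityʳ (ℤ.+ n))))) ⟩
  ℚᵘ.1ℚᵘ ℚᵘ.+ ℚᵘ.mkℚᵘ (ℤ.+ n) 0     ≈⟨ ℚᵘP.+-congʳ ℚᵘ.1ℚᵘ (toℚᵘ-fromℚᵘ (ℚᵘ.mkℚᵘ (ℤ.+ n) 0)) ⟨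
  ℚᵘ.1ℚᵘ ℚᵘ.+ toℚᵘ (ℕ→ℚ n)        ≈⟨ toℚᵘ-homo-+ 1ℚ (ℕ→ℚ n) ⟨
  toℚᵘ (1ℚ + ℕ→ℚ n)               ∎)
  where open ℚᵘP.≃-Reasoning

0≤ℕ→ℚ : ∀ n → 0ℚ ≤ ℕ→ℚ n
0≤ℕ→ℚ zero    = ≤-refl
0≤ℕ→ℚ (suc n) = subst (0ℚ ≤_) (sym (ℕ→ℚ-suc n)) (0≤-+ 0≤1 (0≤ℕ→ℚ n))

ℕ→ℚ-mono : ∀ {m n} → m ℕ.≤ n → ℕ→ℚ m ≤ ℕ→ℚ n
ℕ→ℚ-mono {n = n} ℕ.z≤n = 0≤ℕ→ℚ n
ℕ→ℚ-mono {suc m} {suc n} (ℕ.s≤s m≤n) =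
  subst₂ _≤_ (sym (ℕ→ℚ-suc m)) (sym (ℕ→ℚ-suc n)) (+-monoʳ-≤ 1ℚ (ℕ→ℚ-mono m≤n))

-- Finite sums

0≤-∑ : ∀ {n} (f : Fin n → ℚ) → (∀ i → 0ℚ ≤ f i) → 0ℚ ≤ sum f
0≤-∑ {zero}  f 0≤f = ≤-refl
0≤-∑ {suc n} f 0≤f = 0≤-+ (0≤f zero) (0≤-∑ (f ∘ suc) (0≤f ∘ suc))

∑-mono : ∀ {n} (f g : Fin n → ℚ) → (∀ i → f i ≤ g i) → sum f ≤ sum g
∑-mono {zero}  f g f≤g = ≤-refl
∑-mono {suc n} f g f≤g = +-mono-≤ (f≤g zero) (∑-mono (f ∘ suc) (g ∘ suc) (f≤g ∘ suc))

term≤∑ : ∀ {n} (f : Fin n → ℚ) → (∀ i → 0ℚ ≤ f i) → ∀ i → f i ≤ sum f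
term≤∑ f 0≤f zero    = ≤-witness _ (0≤-∑ (f ∘ suc) (0≤f ∘ suc)) refl
term≤∑ f 0≤f (suc i) = ≤-trans (term≤∑ (f ∘ suc) (0≤f ∘ suc) i)
  (≤-witness (f zero) (0≤f zero) (+-comm (f zero) _))

∑-const : ∀ n (c : ℚ) → sum {n} (λ _ → c) ≡ ℕ→ℚ n * c
∑-const zero    c = sym (*-zeroˡ c)
∑-const (suc n) c = begin
  c + sum {n} (λ _ → c)   ≡⟨ cong (c +_) (∑-const n c) ⟩
  c + ℕ→ℚ n * c           ≡⟨ solve 2 (λ c n → c :+ n :* c := (con 1ℚ :+ n) :* c) refl c (ℕ→ℚ n) ⟩
  (1ℚ + ℕ→ℚ n) * c        ≡⟨ cong (_* c) (ℕ→ℚ-suc n) ⟨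
  ℕ→ℚ (suc n) * c         ∎
  where open ≡-Reasoning

∑-zero : ∀ {n} (f : Fin n → ℚ) → (∀ i → f i ≡ 0ℚ) → sum f ≡ 0ℚ
∑-zero {zero}  f f≡0 = refl
∑-zero {suc n} f f≡0 = cong₂ _+_ (f≡0 zero) (∑-zero (f ∘ suc) (f≡0 ∘ suc))

∑-splitAt : ∀ m {n} (f : Fin (m ℕ.+ n) → ℚ) →
  sum f ≡ sum (λ i → f (i ↑ˡ n)) + sum (λ i → f (m ↑ʳ i))
∑-splitAt zero    f = sym (+-identityˡ _)
∑-splitAt (suc m) f = trans (cong (f zero +_) (∑-splitAt m (f ∘ suc))) (sym (+-assoc (f zero) _ _))

∑-combine : ∀ n {k} (f : Fin (n ℕ.* k) → ℚ) → sum f ≡ sum {n} (λ i → sum {k} (λ j → f (combine i j)))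
∑-combine zero        f = refl
∑-combine (suc n) {k} f = trans (∑-splitAt k f) (cong (sum (λ i → f (i ↑ˡ n ℕ.* k)) +_) (∑-combine n (λ i → f (k ↑ʳ i))))

⟦_⟧ : Bool → ℚ
⟦ b ⟧ = if b then 1ℚ else 0ℚ

0≤⟦_⟧ : ∀ b → 0ℚ ≤ ⟦ b ⟧
0≤⟦ true ⟧  = 0≤1
0≤⟦ false ⟧ = ≤-refl

∑⟦⟧≤1 : ∀ {n} (f : Fin n → Bool) → (∀ i j → f i ≡ true → f j ≡ true → i ≡ j) →
  sum (λ i → ⟦ f i ⟧) ≤ 1ℚ
∑⟦⟧≤1 {zero}  f unique = 0≤1
∑⟦⟧≤1 {suc n} f unique with f zero in eq
... | false = subst (_≤ 1ℚ) (sym (+-identityˡ _)) (∑⟦⟧≤1 (f ∘ suc) unique′)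
  where
  unique′ : ∀ i j → f (suc i) ≡ true → f (suc j) ≡ true → i ≡ j
  unique′ i j fi fj with refl ← unique (suc i) (suc j) fi fj = refl
... | true = ≤-reflexive (cong (1ℚ +_) (∑-zero (λ i → ⟦ f (suc i) ⟧) rest))
  where
  rest : ∀ i → ⟦ f (suc i) ⟧ ≡ 0ℚ
  rest i with f (suc i) in eqᵢ
  ... | false = refl
  ... | true  with () ← unique zero (suc i) eq eqᵢ

∣-∣-∑ : ∀ {n} (S : Subset n) → ℕ→ℚ ∣ S ∣ ≡ sum (λ i → ⟦ lookup S i ⟧)
∣-∣-∑ []          = refl
∣-∣-∑ (true  ∷ S) = trans (ℕ→ℚ-suc ∣ S ∣) (cong (1ℚ +_) (∣-∣-∑ S))
∣-∣-∑ (false ∷ S) = trans (∣-∣-∑ S) (sym (+-identityˡ _))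

-- Expectation over independent coin flips

-- Conditioning on the first coin turns the weighted sum over `allSubsets` into a recursion, so that
-- linearity, monotonicity and independence are inductions on the number of coins; `𝔼≡E` links it to
-- `𝔼`.
E : ℚ → ∀ {m} → (Subset m → ℚ) → ℚ
E p {zero}  f = f []
E p {suc m} f = p * E p (λ S → f (true ∷ S)) + (1ℚ - p) * E p (λ S → f (false ∷ S))

sumᴸ : List.List ℚ → ℚ
sumᴸ = List.foldr _+_ 0ℚ

sumᴸ-++ : ∀ xs ys → sumᴸ (xs List.++ ys) ≡ sumᴸ xs + sumᴸ ys
sumᴸ-++ List.[]       ys = sym (+-identityˡ _)
sumᴸ-++ (x List.∷ xs) ys = trans (cong (x +_) (sumᴸ-++ xs ys)) (sym (+-assoc x _ _))

sumᴸ-scale : ∀ {A : Set} c (f : A → ℚ) xs →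
  sumᴸ (List.map (λ x → c * f x) xs) ≡ c * sumᴸ (List.map f xs)
sumᴸ-scale c f List.[]       = sym (*-zeroʳ c)
sumᴸ-scale c f (x List.∷ xs) =
  trans (cong (c * f x +_) (sumᴸ-scale c f xs)) (sym (*-distribˡ-+ c (f x) _))

weight : ℚ → ∀ {m} → Subset m → ℚ
weight p []      = 1ℚ
weight p (b ∷ S) = (if b then p else 1ℚ - p) * weight p S

prob≡weight : ∀ p G S → prob p G S ≡ weight p S
prob≡weight p G S = trans
  (cong (List.foldr _*_ 1ℚ) (ListP.map-tabulate (λ i → i) (λ i → if lookup S i then p else 1ℚ - p)))
  (go S)
  where
  go : ∀ {m} (S : Subset m) →
    List.foldr _*_ 1ℚ (List.tabulate (λ i → if lookup S i then p else 1ℚ - p)) ≡ weight p S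
  go []      = refl
  go (b ∷ S) = cong ((if b then p else 1ℚ - p) *_) (go S)

∑weight≡E : ∀ p {m} (f : Subset m → ℚ) →
  sumᴸ (List.map (λ S → weight p S * f S) (allSubsets m)) ≡ E p f
∑weight≡E p {zero}  f = trans (+-identityʳ _) (*-identityˡ _)
∑weight≡E p {suc m} f = begin
  sumᴸ (List.map h (List.map (true ∷_) A List.++ List.map (false ∷_) A))
    ≡⟨ cong sumᴸ (ListP.map-++ h (List.map (true ∷_) A) _) ⟩
  sumᴸ (List.map h (List.map (true ∷_) A) List.++ List.map h (List.map (false ∷_) A))
    ≡⟨ sumᴸ-++ (List.map h (List.map (true ∷_) A)) _ ⟩
  sumᴸ (List.map h (List.map (true ∷_) A)) + sumᴸ (List.map h (List.map (false ∷_) A))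
    ≡⟨ cong₂ _+_ (half true) (half false) ⟩
  E p f ∎
  where
  open ≡-Reasoning
  A = allSubsets m
  h : Subset (suc m) → ℚ
  h S = weight p S * f S
  half : ∀ b → sumᴸ (List.map h (List.map (b ∷_) A)) ≡
    (if b then p else 1ℚ - p) * E p (λ S → f (b ∷ S))
  half b = begin
    sumᴸ (List.map h (List.map (b ∷_) A))
      ≡⟨ cong sumᴸ (ListP.map-∘ A) ⟨
    sumᴸ (List.map (λ S → c * weight p S * f (b ∷ S)) A)
      ≡⟨ cong sumᴸ (ListP.map-cong (λ S → *-assoc c (weight p S) (f (b ∷ S))) A) ⟩
    sumᴸ (List.map (λ S → c * (weight p S * f (b ∷ S))) A)
      ≡⟨ sumᴸ-scale c _ A ⟩
    c * sumᴸ (List.map (λ S → weight p S * f (b ∷ S)) A)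
      ≡⟨ cong (c *_) (∑weight≡E p (λ S → f (b ∷ S))) ⟩
    c * E p (λ S → f (b ∷ S)) ∎
    where c = if b then p else 1ℚ - p

𝔼≡E : ∀ p G f → 𝔼 p G f ≡ E p f
𝔼≡E p G f = trans
  (cong sumᴸ (ListP.map-cong (λ S → cong (_* f S) (prob≡weight p G S)) (allSubsets (m G))))
  (∑weight≡E p f)

E-cong : ∀ p {m} {f g : Subset m → ℚ} → (∀ S → f S ≡ g S) → E p f ≡ E p g
E-cong p {zero}  f≡g = f≡g []
E-cong p {suc m} f≡g = cong₂ (λ x y → p * x + (1ℚ - p) * y)
  (E-cong p (f≡g ∘ (true ∷_))) (E-cong p (f≡g ∘ (false ∷_)))

E-+ : ∀ p {m} (f g : Subset m → ℚ) → E p (λ S → f S + g S) ≡ E p f + E p g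
E-+ p {zero}  f g = refl
E-+ p {suc m} f g = trans
  (cong₂ (λ x y → p * x + (1ℚ - p) * y) (E-+ p (f ∘ (true ∷_)) (g ∘ (true ∷_)))
                                        (E-+ p (f ∘ (false ∷_)) (g ∘ (false ∷_))))
  (solve 6 (λ p r a b c d → p :* (a :+ b) :+ r :* (c :+ d) := p :* a :+ r :* c :+ (p :* b :+ r :* d)) refl
    p (1ℚ - p) _ _ _ _)

E-scale : ∀ p {m} c (f : Subset m → ℚ) → E p (λ S → c * f S) ≡ c * E p f
E-scale p {zero}  c f = refl
E-scale p {suc m} c f = trans
  (cong₂ (λ x y → p * x + (1ℚ - p) * y) (E-scale p c (f ∘ (true ∷_))) (E-scale p c (f ∘ (false ∷_))))
  (solve 5 (λ p r c x y → p :* (c :* x) :+ r :* (c :* y) := c :* (p :* x :+ r :* y)) refl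
    p (1ℚ - p) c _ _)

E-const : ∀ p m c → E p {m} (λ _ → c) ≡ c
E-const p zero    c = refl
E-const p (suc m) c = trans (cong (λ x → p * x + (1ℚ - p) * x) (E-const p m c))
  (solve 2 (λ p c → p :* c :+ (con 1ℚ :- p) :* c := c) refl p c)

E-- : ∀ p {m} (f g : Subset m → ℚ) → E p (λ S → f S - g S) ≡ E p f - E p g
E-- p f g = begin
  E p (λ S → f S - g S)                ≡⟨ E-cong p (λ S → cong (f S +_) (neg≡ (g S))) ⟩
  E p (λ S → f S + (- 1ℚ) * g S)       ≡⟨ E-+ p f _ ⟩
  E p f + E p (λ S → (- 1ℚ) * g S)     ≡⟨ cong (E p f +_) (E-scale p (- 1ℚ) g) ⟩
  E p f + (- 1ℚ) * E p g               ≡⟨ cong (E p f +_) (neg≡ (E p g)) ⟨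
  E p f - E p g                        ∎
  where
  open ≡-Reasoning
  neg≡ : ∀ x → - x ≡ (- 1ℚ) * x
  neg≡ = solve 1 (λ x → :- x := (:- con 1ℚ) :* x) refl

E-∑ : ∀ p {m n} (f : Fin n → Subset m → ℚ) →
  E p (λ S → sum (λ i → f i S)) ≡ sum (λ i → E p (f i))
E-∑ p {m} {zero}  f = E-const p m 0ℚ
E-∑ p {m} {suc n} f = trans (E-+ p (f zero) _) (cong (E p (f zero) +_) (E-∑ p (f ∘ suc)))

E-mono : ∀ {p} → 0ℚ ≤ p → p ≤ 1ℚ → ∀ {m} {f g : Subset m → ℚ} →
  (∀ S → f S ≤ g S) → E p f ≤ E p g
E-mono 0≤p p≤1 {zero}  f≤g = f≤g []
E-mono 0≤p p≤1 {suc m} f≤g = +-mono-≤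
  (*-monoˡ-≤ 0≤p (E-mono 0≤p p≤1 (f≤g ∘ (true ∷_))))
  (*-monoˡ-≤ (p≤q⇒0≤q-p p≤1) (E-mono 0≤p p≤1 (f≤g ∘ (false ∷_))))

-- Measurability with respect to the coins in D, expressed through agreement of outcomes; functions
-- of disjoint sets of coins are independent.
DependsOn : ∀ {m} → (Subset m → ℚ) → Pred (Fin m) _ → Set
DependsOn f D = ∀ S T → (∀ i → D i → lookup S i ≡ lookup T i) → f S ≡ f T

DependsOn-⊆ : ∀ {m} {f : Subset m → ℚ} {C D : Pred (Fin m) _} →
  C ⊆ᴾ D → DependsOn f C → DependsOn f D
DependsOn-⊆ C⊆D dep S T eq = dep S T (λ i i∈C → eq i (C⊆D i∈C))

DependsOn-* : ∀ {m} {f g : Subset m → ℚ} {D : Pred (Fin m) _} →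
  DependsOn f D → DependsOn g D → DependsOn (λ S → f S * g S) D
DependsOn-* depf depg S T eq = cong₂ _*_ (depf S T eq) (depg S T eq)

DependsOn-∷ : ∀ {m} {f : Subset (suc m) → ℚ} {D : Pred (Fin (suc m)) _} →
  DependsOn f D → ∀ b → DependsOn (λ S → f (b ∷ S)) (D ∘ suc)
DependsOn-∷ dep b S T eq = dep (b ∷ S) (b ∷ T) λ { zero _ → refl ; (suc i) → eq i }

ignores-head : ∀ {m} {f : Subset (suc m) → ℚ} {D : Pred (Fin (suc m)) _} →
  DependsOn f D → ¬ D zero → ∀ S → f (false ∷ S) ≡ f (true ∷ S)
ignores-head dep 0∉D S = dep (false ∷ S) (true ∷ S)
  λ { zero 0∈D → contradiction 0∈D 0∉D ; (suc i) _ → refl }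

-- At most one of f and g looks at the first coin, and `D?` tells which. The other has the same
-- conditional expectation for both outcomes, so this common value factors out of the two branches.
E-independent : ∀ p {m} {f g : Subset m → ℚ} {D : Pred (Fin m) _} → Decidable D →
  DependsOn f D → DependsOn g (∁ D) → E p (λ S → f S * g S) ≡ E p f * E p g
E-independent p {zero}  D? depf depg = refl
E-independent p {suc m} {f} {g} {D} D? depf depg with D? zero
... | yes 0∈D = begin
  p * E p (λ S → f (true ∷ S) * g (true ∷ S)) + (1ℚ - p) * E p (λ S → f (false ∷ S) * g (false ∷ S))
    ≡⟨ cong₂ (λ x y → p * x + (1ℚ - p) * y) (rec true) (rec false) ⟩
  p * (ft * gt) + (1ℚ - p) * (ff * gf)
    ≡⟨ cong (λ x → p * (ft * gt) + (1ℚ - p) * (ff * x)) gf≡gt ⟩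
  p * (ft * gt) + (1ℚ - p) * (ff * gt)
    ≡⟨ solve 4 (λ p a b c → p :* (a :* c) :+ (con 1ℚ :- p) :* (b :* c)
         := (p :* a :+ (con 1ℚ :- p) :* b) :* (p :* c :+ (con 1ℚ :- p) :* c)) refl p ft ff gt ⟩
  E p f * (p * gt + (1ℚ - p) * gt)
    ≡⟨ cong (λ x → E p f * (p * gt + (1ℚ - p) * x)) gf≡gt ⟨
  E p f * E p g ∎
  where
  open ≡-Reasoning
  ft = E p (λ S → f (true ∷ S))
  ff = E p (λ S → f (false ∷ S))
  gt = E p (λ S → g (true ∷ S))
  gf = E p (λ S → g (false ∷ S))
  rec : ∀ b → E p (λ S → f (b ∷ S) * g (b ∷ S)) ≡ E p (λ S → f (b ∷ S)) * E p (λ S → g (b ∷ S))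
  rec b = E-independent p (D? ∘ suc) (DependsOn-∷ depf b) (DependsOn-∷ depg b)
  gf≡gt : gf ≡ gt
  gf≡gt = E-cong p (ignores-head depg (λ 0∉D → 0∉D 0∈D))
... | no 0∉D = begin
  p * E p (λ S → f (true ∷ S) * g (true ∷ S)) + (1ℚ - p) * E p (λ S → f (false ∷ S) * g (false ∷ S))
    ≡⟨ cong₂ (λ x y → p * x + (1ℚ - p) * y) (rec true) (rec false) ⟩
  p * (ft * gt) + (1ℚ - p) * (ff * gf)
    ≡⟨ cong (λ x → p * (ft * gt) + (1ℚ - p) * (x * gf)) ff≡ft ⟩
  p * (ft * gt) + (1ℚ - p) * (ft * gf)
    ≡⟨ solve 4 (λ p a b c → p :* (c :* a) :+ (con 1ℚ :- p) :* (c :* b)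
         := (p :* c :+ (con 1ℚ :- p) :* c) :* (p :* a :+ (con 1ℚ :- p) :* b)) refl p gt gf ft ⟩
  (p * ft + (1ℚ - p) * ft) * E p g
    ≡⟨ cong (λ x → (p * ft + (1ℚ - p) * x) * E p g) ff≡ft ⟨
  E p f * E p g ∎
  where
  open ≡-Reasoning
  ft = E p (λ S → f (true ∷ S))
  ff = E p (λ S → f (false ∷ S))
  gt = E p (λ S → g (true ∷ S))
  gf = E p (λ S → g (false ∷ S))
  rec : ∀ b → E p (λ S → f (b ∷ S) * g (b ∷ S)) ≡ E p (λ S → f (b ∷ S)) * E p (λ S → g (b ∷ S))
  rec b = E-independent p (D? ∘ suc) (DependsOn-∷ depf b) (DependsOn-∷ depg b)
  ff≡ft : ff ≡ ft
  ff≡ft = E-cong p (ignores-head depf 0∉D)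

X : ∀ {m} → Fin m → Subset m → ℚ
X i S = ⟦ lookup S i ⟧

X-DependsOn : ∀ {m} (i : Fin m) → DependsOn (X i) (_≡ i)
X-DependsOn i S T eq = cong ⟦_⟧ (eq i refl)

E-X : ∀ p {m} (i : Fin m) → E p (X i) ≡ p
E-X p {suc m} zero = trans (cong₂ (λ x y → p * x + (1ℚ - p) * y) (E-const p m 1ℚ) (E-const p m 0ℚ))
  (solve 1 (λ p → p :* con 1ℚ :+ (con 1ℚ :- p) :* con 0ℚ := p) refl p)
E-X p {suc m} (suc i) = trans (cong₂ (λ x y → p * x + (1ℚ - p) * y) (E-X p i) (E-X p i))
  (solve 1 (λ p → p :* p :+ (con 1ℚ :- p) :* p := p) refl p)

infixr 8 _^_
_^_ : ℚ → ℕ → ℚ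
x ^ zero  = 1ℚ
x ^ suc n = x * x ^ n

0≤-^ : ∀ {x} n → 0ℚ ≤ x → 0ℚ ≤ x ^ n
0≤-^ zero    0≤x = 0≤1
0≤-^ (suc n) 0≤x = 0≤-* 0≤x (0≤-^ n 0≤x)

-- The indicator that all coins `e t` fail, as a product of numbers: each factor involves a single
-- coin, so for distinct coins the expectation factors too.
absent : ∀ {d m} → (Fin d → Fin m) → Subset m → ℚ
absent e S = prod (λ t → 1ℚ - X (e t) S)

absent-DependsOn : ∀ {d m} (e : Fin d → Fin m) → DependsOn (absent e) (λ i → ∃ λ t → i ≡ e t)
absent-DependsOn {zero}  e S T eq = refl
absent-DependsOn {suc d} e S T eq = cong₂ _*_
  (cong (λ b → 1ℚ - ⟦ b ⟧) (eq (e zero) (zero , refl)))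
  (absent-DependsOn (e ∘ suc) S T λ { i (t , i≡) → eq i (suc t , i≡) })

E-1-X : ∀ p {m} (i : Fin m) → E p (λ S → 1ℚ - X i S) ≡ 1ℚ - p
E-1-X p {m} i = trans (E-- p (λ _ → 1ℚ) (X i)) (cong₂ _-_ (E-const p m 1ℚ) (E-X p i))

-- Injectivity keeps `e zero` apart from the later coins; a repeated coin would contribute 1 - p
-- only once.
E-absent : ∀ p {d m} (e : Fin d → Fin m) → (∀ {s t} → e s ≡ e t → s ≡ t) →
  E p (absent e) ≡ (1ℚ - p) ^ d
E-absent p {zero}  {m} e e-inj = E-const p m 1ℚ
E-absent p {suc d} {m} e e-inj = begin
  E p (λ S → (1ℚ - X (e zero) S) * absent (e ∘ suc) S)
    ≡⟨ E-independent p {D = _≡ e zero} (Fin._≟ e zero)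
         (λ S T eq → cong (λ b → 1ℚ - ⟦ b ⟧) (eq (e zero) refl))
         (DependsOn-⊆ (λ { (t , i≡) i≡e₀ → contradiction (e-inj (trans (sym i≡) i≡e₀)) λ () })
           (absent-DependsOn (e ∘ suc))) ⟩
  E p (λ S → 1ℚ - X (e zero) S) * E p (absent (e ∘ suc))
    ≡⟨ cong₂ _*_ (E-1-X p (e zero)) (E-absent p (e ∘ suc) (FinP.suc-injective ∘ e-inj)) ⟩
  (1ℚ - p) ^ suc d ∎
  where open ≡-Reasoning

absent≡1 : ∀ {d m} (e : Fin d → Fin m) S → (∀ t → lookup S (e t) ≡ false) → absent e S ≡ 1ℚ
absent≡1 {zero}  e S all = refl
absent≡1 {suc d} e S all = cong₂ (λ b x → (1ℚ - ⟦ b ⟧) * x) (all zero) (absent≡1 (e ∘ suc) S (all ∘ suc))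

absent≡0 : ∀ {d m} (e : Fin d → Fin m) S t → lookup S (e t) ≡ true → absent e S ≡ 0ℚ
absent≡0 e S zero    present =
  trans (cong (λ b → (1ℚ - ⟦ b ⟧) * absent (e ∘ suc) S) present) (*-zeroˡ (absent (e ∘ suc) S))
absent≡0 e S (suc t) present =
  trans (cong ((1ℚ - X (e zero) S) *_) (absent≡0 (e ∘ suc) S t present)) (*-zeroʳ (1ℚ - X (e zero) S))

⌊⌋-true : ∀ {A : Set} (A? : Dec A) → A → ⌊ A? ⌋ ≡ true
⌊⌋-true (yes _) a = refl
⌊⌋-true (no ¬a) a = contradiction a ¬a

⌊⌋-false : ∀ {A : Set} (A? : Dec A) → ¬ A → ⌊ A? ⌋ ≡ false
⌊⌋-false (yes a) ¬a = contradiction a ¬a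
⌊⌋-false (no _)  ¬a = refl

⌊⌋-true⁻¹ : ∀ {A : Set} (A? : Dec A) → ⌊ A? ⌋ ≡ true → A
⌊⌋-true⁻¹ (yes a) _ = a

-- Maximum matchings and maximum degrees

≤-foldr-⊔ : ∀ {A : Set} (f : A → ℕ) {x xs} → x L∈.∈ xs → f x ℕ.≤ List.foldr ℕ._⊔_ 0 (List.map f xs)
≤-foldr-⊔ f (here refl) = ℕP.m≤m⊔n _ _
≤-foldr-⊔ f (there x∈)  = ℕP.≤-trans (≤-foldr-⊔ f x∈) (ℕP.m≤n⊔m _ _)

∈-allSubsets : ∀ {k} (S : Subset k) → S L∈.∈ allSubsets k
∈-allSubsets []          = here refl
∈-allSubsets (true  ∷ S) = L∈P.∈-++⁺ˡ (L∈P.∈-map⁺ (true ∷_) (∈-allSubsets S))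
∈-allSubsets (false ∷ S) = L∈P.∈-++⁺ʳ _ (L∈P.∈-map⁺ (false ∷_) (∈-allSubsets S))

allᵇ-true : ∀ k {f : Fin k → Bool} → (∀ i → f i ≡ true) → allᵇ k f ≡ true
allᵇ-true k {f} all = go (List.allFin k)
  where
  go : ∀ xs → List.foldr _∧_ true (List.map f xs) ≡ true
  go List.[]       = refl
  go (x List.∷ xs) = cong₂ _∧_ (all x) (go xs)

-- `μ` is a maximum over all edge sets in which inadmissible ones score 0, so M is one of the
-- candidates and, having passed both Boolean tests, scores its own size.
∣M∣≤μ : ∀ G {M S : EdgeSet G} → (∀ i → lookup M i ≡ true → lookup S i ≡ true) →
  (∀ i j → lookup M i ≡ true → lookup M j ≡ true → i ≢ j →
    (proj₁ (edge G i) ≢ proj₁ (edge G j)) × (proj₂ (edge G i) ≢ proj₂ (edge G j))) →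
  ∣ M ∣ ℕ.≤ μ G S
∣M∣≤μ G {M} {S} M⊆S matching = subst (ℕ._≤ μ G S)
  (cong₂ (λ b c → if b ∧ c then ∣ M ∣ else 0) sub match)
  (≤-foldr-⊔ (λ M → if ⊆ᵇ M S ∧ isMatchingᵇ G M then ∣ M ∣ else 0) (∈-allSubsets M))
  where
  sub : ⊆ᵇ M S ≡ true
  sub = allᵇ-true (m G) go
    where
    go : ∀ i → (if lookup M i then lookup S i else true) ≡ true
    go i with lookup M i in eq
    ... | true  = M⊆S i eq
    ... | false = refl
  match : isMatchingᵇ G M ≡ true
  match = allᵇ-true (m G) λ i → allᵇ-true (m G) (go i)
    where
    go : ∀ i j → (if lookup M i ∧ lookup M j ∧ not ⌊ i Fin.≟ j ⌋
      then not ⌊ proj₁ (edge G i) Fin.≟ proj₁ (edge G j) ⌋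
           ∧ not ⌊ proj₂ (edge G i) Fin.≟ proj₂ (edge G j) ⌋
      else true) ≡ true
    go i j with lookup M i in Mi | lookup M j in Mj | i Fin.≟ j
    ... | false | _     | _     = refl
    ... | true  | false | _     = refl
    ... | true  | true  | yes _ = refl
    ... | true  | true  | no i≢j
      with l≢ , r≢ ← matching i j Mi Mj i≢j =
      cong₂ (λ b c → not b ∧ not c) (⌊⌋-false (_ Fin.≟ _) l≢) (⌊⌋-false (_ Fin.≟ _) r≢)

degR≤maxDeg : ∀ G Q v → degR G Q v ℕ.≤ maxDeg G Q
degR≤maxDeg G Q v = ℕP.≤-trans (≤-foldr-⊔ (degR G Q) (L∈P.∈-allFin v))
  (ℕP.m≤n⊔m (List.foldr ℕ._⊔_ 0 (List.map (degL G Q) (List.allFin (left G)))) _)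

true-or-allFalse : ∀ {d} (f : Fin d → Bool) → (∃ λ t → f t ≡ true) ⊎ (∀ t → f t ≡ false)
true-or-allFalse f with FinP.any? (λ t → f t Bool.≟ true)
... | yes ∃t = inj₁ ∃t
... | no ∄t  = inj₂ λ t → ¬-not (λ ft → ∄t (t , ft))

pick : ∀ {d} → (Fin d → Bool) → Maybe (Fin d)
pick f with true-or-allFalse f
... | inj₁ (t , _) = just t
... | inj₂ _       = nothing

pick-sound : ∀ {d} (f : Fin d → Bool) {t} → pick f ≡ just t → f t ≡ true
pick-sound f eq with true-or-allFalse f
pick-sound f refl | inj₁ (_ , ft) = ft

pick-complete : ∀ {d} (f : Fin d → Bool) t → f t ≡ true → ∃ λ s → pick f ≡ just s
pick-complete f t ft with true-or-allFalse f
... | inj₁ (s , _) = s , refl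
... | inj₂ none    = contradiction (trans (sym ft) (none t)) λ ()

-- The hard graph

module HardGraph (n k d : ℕ) where

  #edges : ℕ
  #edges = n ℕ.* (k ℕ.+ d)

  core : Fin n → Fin k → Fin #edges
  core j u = combine j (u ↑ˡ d)

  leaf : Fin n → Fin d → Fin #edges
  leaf j t = combine j (k ↑ʳ t)

  data EdgeView : Fin #edges → Set where
    isCore : ∀ j u → EdgeView (core j u)
    isLeaf : ∀ j t → EdgeView (leaf j t)

  edgeView : ∀ i → EdgeView i
  edgeView i with FinP.combine-surjective {n} {k ℕ.+ d} i
  ... | j , r , refl with splitAt k r in eq
  ...   | inj₁ u = subst (EdgeView ∘ combine j) (FinP.splitAt⁻¹-↑ˡ eq) (isCore j u)
  ...   | inj₂ t = subst (EdgeView ∘ combine j) (FinP.splitAt⁻¹-↑ʳ eq) (isLeaf j t)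

  core-injectiveʳ : ∀ j {u u′} → core j u ≡ core j u′ → u ≡ u′
  core-injectiveʳ j = FinP.↑ˡ-injective d _ _ ∘ FinP.combine-injectiveʳ j _ j _

  leaf-injectiveʳ : ∀ j {t t′} → leaf j t ≡ leaf j t′ → t ≡ t′
  leaf-injectiveʳ j = FinP.↑ʳ-injective k _ _ ∘ FinP.combine-injectiveʳ j _ j _

  splitRow : ∀ {A : Set} → (Fin n → Fin k → A) → (Fin n → Fin d → A) → Fin n × Fin (k ℕ.+ d) → A
  splitRow f g (j , r) = [ f j , g j ]′ (splitAt k r)

  split : ∀ {A : Set} → (Fin n → Fin k → A) → (Fin n → Fin d → A) → Fin #edges → A
  split f g i = splitRow f g (remQuot {n} (k ℕ.+ d) i)

  split-core : ∀ {A : Set} (f : Fin n → Fin k → A) g j u → split f g (core j u) ≡ f j u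
  split-core f g j u = trans (cong (splitRow f g) (FinP.remQuot-combine j (u ↑ˡ d)))
    (cong [ f j , g j ]′ (FinP.splitAt-↑ˡ k u d))

  split-leaf : ∀ {A : Set} (f : Fin n → Fin k → A) g j t → split f g (leaf j t) ≡ g j t
  split-leaf f g j t = trans (cong (splitRow f g) (FinP.remQuot-combine j (k ↑ʳ t)))
    (cong [ f j , g j ]′ (FinP.splitAt-↑ʳ k d t))

  core≢leaf : ∀ {j u j′ t} → core j u ≢ leaf j′ t
  -- A Boolean-valued `split` separates the two kinds of edges.
  core≢leaf {j} {u} {j′} {t} eq = contradiction
    (trans (sym (split-core (λ _ _ → true) (λ _ _ → false) j u))
      (trans (cong (split _ _) eq) (split-leaf (λ _ _ → true) (λ _ _ → false) j′ t))) λ ()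

  coreEnds : Fin n → Fin k → Fin n × Fin (k ℕ.+ #edges)
  coreEnds j u = j , u ↑ˡ #edges

  -- The private right end of a leaf edge is indexed by that edge itself; the
  -- right vertices indexed by core edges stay isolated.
  leafEnds : Fin n → Fin d → Fin n × Fin (k ℕ.+ #edges)
  leafEnds j t = j , k ↑ʳ leaf j t

  endpoints : Fin #edges → Fin n × Fin (k ℕ.+ #edges)
  endpoints = split coreEnds leafEnds

  endpoints-core : ∀ j u → endpoints (core j u) ≡ (j , u ↑ˡ #edges)
  endpoints-core = split-core coreEnds leafEnds

  endpoints-leaf : ∀ j t → endpoints (leaf j t) ≡ (j , k ↑ʳ leaf j t)
  endpoints-leaf = split-leaf coreEnds leafEnds

  ↑ˡ≢↑ʳ : ∀ {m′} {u : Fin k} {i : Fin m′} → u ↑ˡ m′ ≢ k ↑ʳ i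
  ↑ˡ≢↑ʳ {m′} {u} {i} eq = contradiction
    (trans (sym (FinP.splitAt-↑ˡ k u m′)) (trans (cong (splitAt k) eq) (FinP.splitAt-↑ʳ k m′ i))) λ ()

  endpoints-injective : ∀ {i i′} → endpoints i ≡ endpoints i′ → i ≡ i′
  endpoints-injective {i} {i′} eq with edgeView i | edgeView i′
  ... | isCore j u | isCore j′ u′ = cong₂ core (,-injectiveˡ eq′) (FinP.↑ˡ-injective _ _ _ (,-injectiveʳ eq′))
    where eq′ = trans (sym (endpoints-core j u)) (trans eq (endpoints-core j′ u′))
  ... | isCore j u | isLeaf j′ t′ = contradiction (,-injectiveʳ eq′) ↑ˡ≢↑ʳ
    where eq′ = trans (sym (endpoints-core j u)) (trans eq (endpoints-leaf j′ t′))
  ... | isLeaf j t | isCore j′ u′ = contradiction (sym (,-injectiveʳ eq′)) ↑ˡ≢↑ʳ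
    where eq′ = trans (sym (endpoints-leaf j t)) (trans eq (endpoints-core j′ u′))
  ... | isLeaf j t | isLeaf j′ t′ = FinP.↑ʳ-injective k _ _ (,-injectiveʳ eq′)
    where eq′ = trans (sym (endpoints-leaf j t)) (trans eq (endpoints-leaf j′ t′))

  G : BipGraph
  G = record { left = n ; right = k ℕ.+ #edges ; m = #edges ; edge = endpoints ; simple = endpoints-injective }

  ∑-edges : ∀ (f : Fin #edges → ℚ) →
    sum f ≡ sum (λ j → sum (λ u → f (core j u)) + sum (λ t → f (leaf j t)))
  ∑-edges f = trans (∑-combine n f) (sum-cong-≗ λ j → ∑-splitAt k (λ r → f (combine {n} j r)))

  -- Upper bound for a matching inside Q ∩ S

  unmatched : Fin n → Subset #edges → ℚ
  unmatched j = absent (leaf j)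

  ⟦M⟧≤⟦Q⟧*X : ∀ {Q S M : Subset #edges} → M ⊆ Q ∩ S → ∀ i → ⟦ lookup M i ⟧ ≤ ⟦ lookup Q i ⟧ * X i S
  ⟦M⟧≤⟦Q⟧*X {Q} {S} {M} M⊆Q∩S i with lookup M i in eq
  ... | false = 0≤-* 0≤⟦ lookup Q i ⟧ 0≤⟦ lookup S i ⟧
  ... | true with i∈Q , i∈S ← x∈p∩q⁻ Q S (M⊆Q∩S (VecP.lookup⇒[]= i M eq))
    = ≤-reflexive (sym (cong₂ (λ b c → ⟦ b ⟧ * ⟦ c ⟧) (VecP.[]=⇒lookup i∈Q) (VecP.[]=⇒lookup i∈S)))

  module _ {Q S M : Subset #edges} (M⊆Q∩S : M ⊆ Q ∩ S) (matching : IsMatching G M) where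

    leftEnd : ∀ j r → proj₁ (endpoints (combine {n} j r)) ≡ j
    leftEnd j r with splitAt k r in eq
    ... | inj₁ u with refl ← FinP.splitAt⁻¹-↑ˡ {k} {d} {r} eq = cong proj₁ (endpoints-core j u)
    ... | inj₂ t with refl ← FinP.splitAt⁻¹-↑ʳ {k} {d} {r} eq = cong proj₁ (endpoints-leaf j t)

    row≤1 : ∀ j → sum (λ u → ⟦ lookup M (core j u) ⟧) + sum (λ t → ⟦ lookup M (leaf j t) ⟧) ≤ 1ℚ
    row≤1 j = subst (_≤ 1ℚ) (∑-splitAt k (λ r → ⟦ lookup M (combine {n} j r) ⟧))
      (∑⟦⟧≤1 (λ r → lookup M (combine {n} j r)) unique)
      where
      unique : ∀ r s → lookup M (combine {n} j r) ≡ true → lookup M (combine {n} j s) ≡ true → r ≡ s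
      unique r s Mr Ms with r Fin.≟ s
      ... | yes r≡s = r≡s
      ... | no r≢s = contradiction (trans (leftEnd j r) (sym (leftEnd j s)))
        (proj₁ (matching (combine j r) (combine j s) (VecP.lookup⇒[]= _ M Mr) (VecP.lookup⇒[]= _ M Ms)
          (r≢s ∘ FinP.combine-injectiveʳ j r j s)))

    -- If some leaf edge of v_j is present, `unmatched j S` is 0 and the right side is the trivial
    -- bound 1. Otherwise M contains no leaf edge of v_j, and its core edges there are bounded one
    -- by one by membership in Q and S. The factor `unmatched j S` on the core terms is what brings
    -- q into their expectation.
    row≤ : ∀ j → sum (λ u → ⟦ lookup M (core j u) ⟧) + sum (λ t → ⟦ lookup M (leaf j t) ⟧) ≤
      (1ℚ - unmatched j S) + sum (λ u → ⟦ lookup Q (core j u) ⟧ * (X (core j u) S * unmatched j S))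
    row≤ j with true-or-allFalse (λ t → lookup S (leaf j t))
    ... | inj₁ (t , St) = ≤-trans (row≤1 j) (≤-reflexive (sym (begin
      (1ℚ - unmatched j S) + sum (λ u → ⟦ lookup Q (core j u) ⟧ * (X (core j u) S * unmatched j S))
        ≡⟨ cong (λ x → (1ℚ - x) + sum (λ u → ⟦ lookup Q (core j u) ⟧ * (X (core j u) S * x))) (absent≡0 (leaf j) S t St) ⟩
      1ℚ + sum (λ u → ⟦ lookup Q (core j u) ⟧ * (X (core j u) S * 0ℚ))
        ≡⟨ cong (1ℚ +_) (∑-zero (λ u → ⟦ lookup Q (core j u) ⟧ * (X (core j u) S * 0ℚ)) (λ u →
             trans (cong (⟦ lookup Q (core j u) ⟧ *_) (*-zeroʳ (X (core j u) S))) (*-zeroʳ ⟦ lookup Q (core j u) ⟧))) ⟩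
      1ℚ ∎)))
      where open ≡-Reasoning
    ... | inj₂ none = subst₂ _≤_
      (sym (trans (cong (sum (λ u → ⟦ lookup M (core j u) ⟧) +_) (∑-zero (λ t → ⟦ lookup M (leaf j t) ⟧) M-leaf)) (+-identityʳ _)))
      (sym (trans (cong (λ x → (1ℚ - x) + sum (λ u → ⟦ lookup Q (core j u) ⟧ * (X (core j u) S * x))) (absent≡1 (leaf j) S none))
        (+-identityˡ _)))
      (∑-mono _ _ λ u → subst (λ x → ⟦ lookup M (core j u) ⟧ ≤ ⟦ lookup Q (core j u) ⟧ * x)
        (sym (*-identityʳ (X (core j u) S))) (⟦M⟧≤⟦Q⟧*X M⊆Q∩S (core j u)))
      where
      M-leaf : ∀ t → ⟦ lookup M (leaf j t) ⟧ ≡ 0ℚ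
      M-leaf t with lookup M (leaf j t) in eq
      ... | false = refl
      ... | true with _ , t∈S ← x∈p∩q⁻ Q S (M⊆Q∩S (VecP.lookup⇒[]= _ M eq))
        = contradiction (trans (sym (VecP.[]=⇒lookup t∈S)) (none t)) λ ()

    matching-size≤ : ℕ→ℚ ∣ M ∣ ≤ sum (λ j → (1ℚ - unmatched j S) +
      sum (λ u → ⟦ lookup Q (core j u) ⟧ * (X (core j u) S * unmatched j S)))
    matching-size≤ = subst (_≤ _) (sym (trans (∣-∣-∑ M) (∑-edges (λ i → ⟦ lookup M i ⟧)))) (∑-mono _ _ row≤)

  -- The core edges of Q at the common vertex u, one for each j, are among those counted by `degR`
  -- there.
  ∑-core≤maxDeg : ∀ Q u → sum (λ j → ⟦ lookup Q (core j u) ⟧) ≤ ℕ→ℚ (maxDeg G Q)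
  ∑-core≤maxDeg Q u = begin
    sum (λ j → ⟦ lookup Q (core j u) ⟧)
      ≤⟨ ∑-mono _ _ bound ⟩
    sum (λ j → sum (λ u′ → h (core j u′)) + sum (λ t → h (leaf j t)))
      ≡⟨ ∑-edges h ⟨
    sum h
      ≡⟨ ∣-∣-∑ (Q ∩ at) ⟨
    ℕ→ℚ (degR G Q v)
      ≤⟨ ℕ→ℚ-mono (degR≤maxDeg G Q v) ⟩
    ℕ→ℚ (maxDeg G Q) ∎
    where
    open ≤-Reasoning
    v : Fin (k ℕ.+ #edges)
    v = u ↑ˡ #edges
    at : Subset #edges
    at = tabulate (λ i → ⌊ proj₂ (endpoints i) Fin.≟ v ⌋)
    h : Fin #edges → ℚ
    h i = ⟦ lookup (Q ∩ at) i ⟧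
    0≤h : ∀ i → 0ℚ ≤ h i
    0≤h i = 0≤⟦ lookup (Q ∩ at) i ⟧
    lookup-at : ∀ j → lookup (Q ∩ at) (core j u) ≡ lookup Q (core j u)
    lookup-at j = trans (VecP.lookup-zipWith _∧_ (core j u) Q at)
      (trans (cong (lookup Q (core j u) ∧_) (trans (VecP.lookup∘tabulate _ (core j u))
        (⌊⌋-true (_ Fin.≟ v) (cong proj₂ (endpoints-core j u))))) (∧-identityʳ _))
    bound : ∀ j → ⟦ lookup Q (core j u) ⟧ ≤ sum (λ u′ → h (core j u′)) + sum (λ t → h (leaf j t))
    bound j = ≤-trans (≤-reflexive (cong ⟦_⟧ (sym (lookup-at j))))
      (≤-trans (term≤∑ (h ∘ core j) (0≤h ∘ core j) u)
        (≤-witness (sum (λ t → h (leaf j t))) (0≤-∑ (h ∘ leaf j) (0≤h ∘ leaf j)) refl))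

  -- A matching in G_p from leaf edges and private core edges

  module _ (S : Subset #edges) where

    Isolated : Fin n → Set
    Isolated j = ∀ t → lookup S (leaf j t) ≡ false

    Augmenting : Fin n → Fin k → Set
    Augmenting j u = lookup S (core j u) ≡ true × Isolated j

    -- The two clauses differ on purpose. At v_j every present core edge is a rival, since v_j is
    -- already isolated. At u only augmenting edges are rivals: a core edge at a v_j′ with a present
    -- leaf is never selected, and leaving it out keeps the expected number of rivals near n p q
    -- instead of n p, which is of order 1 / q.
    Private : Fin n → Fin k → Set
    Private j u = Augmenting j u × (∀ u′ → u′ ≢ u → lookup S (core j u′) ≢ true)
                                 × (∀ j′ → j′ ≢ j → ¬ Augmenting j′ u)

    isolated? : ∀ j → Dec (Isolated j)
    isolated? j = FinP.all? λ t → lookup S (leaf j t) Bool.≟ false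

    augmenting? : ∀ j u → Dec (Augmenting j u)
    augmenting? j u = (lookup S (core j u) Bool.≟ true) ×-dec isolated? j

    private? : ∀ j u → Dec (Private j u)
    private? j u = augmenting? j u
      ×-dec FinP.all? (λ u′ → ¬? (u′ Fin.≟ u) →-dec ¬? (lookup S (core j u′) Bool.≟ true))
      ×-dec FinP.all? (λ j′ → ¬? (j′ Fin.≟ j) →-dec ¬? (augmenting? j′ u))

    -- Selecting by a function of j admits at most one leaf edge per left vertex.
    firstLeaf : Fin n → Maybe (Fin d)
    firstLeaf j = pick (λ t → lookup S (leaf j t))

    firstLeaf? : ∀ j t → Dec (firstLeaf j ≡ just t)
    firstLeaf? j t = MaybeP.≡-dec Fin._≟_ (firstLeaf j) (just t)

    -- Conflicting core edges are all dropped, with no attempt to save one of them. Pair counts then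
    -- bound the probability of selection from below, and with k p + n p q ≤ 1/2 at most half of the
    -- useful edges are lost in expectation.
    inGreedy : Fin #edges → Bool
    inGreedy = split (λ j u → ⌊ private? j u ⌋) (λ j t → ⌊ firstLeaf? j t ⌋)

    greedy : Subset #edges
    greedy = tabulate inGreedy

    lookup-core : ∀ j u → lookup greedy (core j u) ≡ ⌊ private? j u ⌋
    lookup-core j u = trans (VecP.lookup∘tabulate inGreedy (core j u))
      (split-core (λ j u → ⌊ private? j u ⌋) (λ j t → ⌊ firstLeaf? j t ⌋) j u)

    lookup-leaf : ∀ j t → lookup greedy (leaf j t) ≡ ⌊ firstLeaf? j t ⌋
    lookup-leaf j t = trans (VecP.lookup∘tabulate inGreedy (leaf j t))
      (split-leaf (λ j u → ⌊ private? j u ⌋) (λ j t → ⌊ firstLeaf? j t ⌋) j t)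

    greedy-core⁻¹ : ∀ j u → lookup greedy (core j u) ≡ true → Private j u
    greedy-core⁻¹ j u M = ⌊⌋-true⁻¹ (private? j u) (trans (sym (lookup-core j u)) M)

    greedy-leaf⁻¹ : ∀ j t → lookup greedy (leaf j t) ≡ true → firstLeaf j ≡ just t
    greedy-leaf⁻¹ j t M = ⌊⌋-true⁻¹ (firstLeaf? j t) (trans (sym (lookup-leaf j t)) M)

    firstLeaf-sound : ∀ j t → firstLeaf j ≡ just t → lookup S (leaf j t) ≡ true
    firstLeaf-sound j t = pick-sound (λ t → lookup S (leaf j t))

    greedy⊆S : ∀ i → lookup greedy i ≡ true → lookup S i ≡ true
    greedy⊆S i M with edgeView i
    ... | isCore j u = proj₁ (proj₁ (greedy-core⁻¹ j u M))
    ... | isLeaf j t = firstLeaf-sound j t (greedy-leaf⁻¹ j t M)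

    isolated⇒¬firstLeaf : ∀ {j t} → Isolated j → firstLeaf j ≢ just t
    isolated⇒¬firstLeaf {j} {t} iso first =
      contradiction (trans (sym (firstLeaf-sound j t first)) (iso t)) λ ()

    Disjoint : Fin n × Fin (k ℕ.+ #edges) → Fin n × Fin (k ℕ.+ #edges) → Set
    Disjoint x y = proj₁ x ≢ proj₁ y × proj₂ x ≢ proj₂ y

    -- Two core edges with a common left end violate the first rival clause of `Private`, those with
    -- a common right end the second. A selected core edge needs its left vertex isolated, a
    -- selected leaf edge needs the opposite. Two leaf edges can meet only at a left vertex, where
    -- the choice is unique.
    greedy-matching : ∀ i i′ → lookup greedy i ≡ true → lookup greedy i′ ≡ true → i ≢ i′ →
      Disjoint (endpoints i) (endpoints i′)
    greedy-matching i i′ M M′ i≢i′ with edgeView i | edgeView i′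
    ... | isCore j u | isCore j′ u′ =
      subst₂ Disjoint (sym (endpoints-core j u)) (sym (endpoints-core j′ u′)) (l≢ , r≢)
      where
      l≢ : j ≢ j′
      l≢ refl = proj₁ (proj₂ (greedy-core⁻¹ j u M)) u′ (λ { refl → i≢i′ refl })
        (proj₁ (proj₁ (greedy-core⁻¹ j u′ M′)))
      r≢ : u ↑ˡ #edges ≢ u′ ↑ˡ #edges
      r≢ eq with refl ← FinP.↑ˡ-injective #edges u u′ eq =
        proj₂ (proj₂ (greedy-core⁻¹ j u M)) j′ (λ { refl → i≢i′ refl }) (proj₁ (greedy-core⁻¹ j′ u M′))
    ... | isCore j u | isLeaf j′ t′ =
      subst₂ Disjoint (sym (endpoints-core j u)) (sym (endpoints-leaf j′ t′)) (l≢ , ↑ˡ≢↑ʳ)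
      where
      l≢ : j ≢ j′
      l≢ refl = isolated⇒¬firstLeaf (proj₂ (proj₁ (greedy-core⁻¹ j u M))) (greedy-leaf⁻¹ j t′ M′)
    ... | isLeaf j t | isCore j′ u′ =
      subst₂ Disjoint (sym (endpoints-leaf j t)) (sym (endpoints-core j′ u′)) (l≢ , ↑ˡ≢↑ʳ ∘ sym)
      where
      l≢ : j ≢ j′
      l≢ refl = isolated⇒¬firstLeaf (proj₂ (proj₁ (greedy-core⁻¹ j u′ M′))) (greedy-leaf⁻¹ j t M)
    ... | isLeaf j t | isLeaf j′ t′ =
      subst₂ Disjoint (sym (endpoints-leaf j t)) (sym (endpoints-leaf j′ t′))
        (l≢ , i≢i′ ∘ FinP.↑ʳ-injective k (leaf j t) (leaf j′ t′))
      where
      l≢ : j ≢ j′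
      l≢ refl = i≢i′ (cong (leaf j) (MaybeP.just-injective
        (trans (sym (greedy-leaf⁻¹ j t M)) (greedy-leaf⁻¹ j t′ M′))))

  -- Counting the rivals of a useful core edge

  distinct : ∀ {m} → Fin m → Fin m → ℚ
  distinct i j = ⟦ not ⌊ i Fin.≟ j ⌋ ⟧

  0≤distinct : ∀ {m} (i j : Fin m) → 0ℚ ≤ distinct i j
  0≤distinct i j = 0≤⟦ not ⌊ i Fin.≟ j ⌋ ⟧

  distinct≡1 : ∀ {m} {i j : Fin m} → i ≢ j → distinct i j ≡ 1ℚ
  distinct≡1 {i = i} {j} i≢j = cong (λ b → ⟦ not b ⟧) (⌊⌋-false (i Fin.≟ j) i≢j)

  augment : Fin n → Fin k → Subset #edges → ℚ
  augment j u S = X (core j u) S * unmatched j S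

  -- The superscript names the end that varies. The factor `unmatched j` is left to `augment j u`,
  -- by which `privateLB` multiplies; repeating it here would spoil the product of independent
  -- variables.
  collisionsʳ : Fin n → Fin k → Subset #edges → ℚ
  collisionsʳ j u S = sum λ u′ → distinct u′ u * X (core j u′) S

  collisionsˡ : Fin n → Fin k → Subset #edges → ℚ
  collisionsˡ j u S = sum λ j′ → distinct j′ j * augment j′ u S

  -- Below the indicator of Private j u whenever v_j is isolated, and, unlike it,
  -- a combination of products of independent variables.
  privateLB : Fin n → Fin k → Subset #edges → ℚ
  privateLB j u S = augment j u S * (1ℚ - collisionsʳ j u S - collisionsˡ j u S)

  unmatched-isolated : ∀ {S j} → Isolated S j → unmatched j S ≡ 1ℚ
  unmatched-isolated {S} {j} = absent≡1 (leaf j) S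

  0≤unmatched : ∀ j S → 0ℚ ≤ unmatched j S
  0≤unmatched j S with true-or-allFalse (λ t → lookup S (leaf j t))
  ... | inj₁ (t , St) = ≤-reflexive (sym (absent≡0 (leaf j) S t St))
  ... | inj₂ isolated = subst (0ℚ ≤_) (sym (unmatched-isolated {S} {j} isolated)) 0≤1

  0≤augment : ∀ j u S → 0ℚ ≤ augment j u S
  0≤augment j u S = 0≤-* 0≤⟦ lookup S (core j u) ⟧ (0≤unmatched j S)

  augment≡1 : ∀ {S j u} → Augmenting S j u → augment j u S ≡ 1ℚ
  augment≡1 {S} {j} (Sju , iso) = cong₂ _*_ (cong ⟦_⟧ Sju) (unmatched-isolated {S} {j} iso)

  augment≡0 : ∀ {S j u} → Isolated S j → ¬ Augmenting S j u → augment j u S ≡ 0ℚ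
  augment≡0 {S} {j} {u} iso ¬aug with lookup S (core j u) in eq
  ... | true  = contradiction (refl , iso) ¬aug
  ... | false = *-zeroˡ (unmatched j S)

  1-x-y≤1 : ∀ {x y} → 0ℚ ≤ x → 0ℚ ≤ y → 1ℚ - x - y ≤ 1ℚ
  1-x-y≤1 {x} {y} 0≤x 0≤y = ≤-witness (x + y) (0≤-+ 0≤x 0≤y)
    (solve 2 (λ x y → con 1ℚ := con 1ℚ :- x :- y :+ (x :+ y)) refl x y)

  1-x-y≤0ˡ : ∀ {x y} → 1ℚ ≤ x → 0ℚ ≤ y → 1ℚ - x - y ≤ 0ℚ
  1-x-y≤0ˡ {x} {y} 1≤x 0≤y = ≤-witness (x - 1ℚ + y) (0≤-+ (p≤q⇒0≤q-p 1≤x) 0≤y)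
    (solve 2 (λ x y → con 0ℚ := con 1ℚ :- x :- y :+ (x :- con 1ℚ :+ y)) refl x y)

  1-x-y≤0ʳ : ∀ {x y} → 0ℚ ≤ x → 1ℚ ≤ y → 1ℚ - x - y ≤ 0ℚ
  1-x-y≤0ʳ {x} {y} 0≤x 1≤y = ≤-witness (y - 1ℚ + x) (0≤-+ (p≤q⇒0≤q-p 1≤y) 0≤x)
    (solve 2 (λ x y → con 0ℚ := con 1ℚ :- x :- y :+ (y :- con 1ℚ :+ x)) refl x y)

  module _ (j : Fin n) (u : Fin k) (S : Subset #edges) where

    private
      termʳ : ∀ u′ → 0ℚ ≤ distinct u′ u * X (core j u′) S
      termʳ u′ = 0≤-* (0≤distinct u′ u) 0≤⟦ lookup S (core j u′) ⟧

      termˡ : ∀ j′ → 0ℚ ≤ distinct j′ j * augment j′ u S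
      termˡ j′ = 0≤-* (0≤distinct j′ j) (0≤augment j′ u S)

    0≤collisionsʳ : 0ℚ ≤ collisionsʳ j u S
    0≤collisionsʳ = 0≤-∑ _ termʳ

    0≤collisionsˡ : 0ℚ ≤ collisionsˡ j u S
    0≤collisionsˡ = 0≤-∑ _ termˡ

    1≤collisionsʳ : ∀ u′ → u′ ≢ u → lookup S (core j u′) ≡ true → 1ℚ ≤ collisionsʳ j u S
    1≤collisionsʳ u′ u′≢u Su′ = ≤-trans
      (≤-reflexive (sym (cong₂ _*_ (distinct≡1 u′≢u) (cong ⟦_⟧ Su′))))
      (term≤∑ (λ u′ → distinct u′ u * X (core j u′) S) termʳ u′)

    1≤collisionsˡ : ∀ j′ → j′ ≢ j → Augmenting S j′ u → 1ℚ ≤ collisionsˡ j u S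
    1≤collisionsˡ j′ j′≢j aug = ≤-trans
      (≤-reflexive (sym (cong₂ _*_ (distinct≡1 j′≢j) (augment≡1 {S} aug))))
      (term≤∑ (λ j′ → distinct j′ j * augment j′ u S) termˡ j′)

    -- A union bound: for an augmenting edge that is not private, a single rival already makes one
    -- collision sum at least 1 and the bracket at most 0; for a private one the bracket is at most
    -- 1.
    privateLB≤ : Isolated S j → (P? : Dec (Private S j u)) → privateLB j u S ≤ ⟦ ⌊ P? ⌋ ⟧
    privateLB≤ iso P? with augmenting? S j u
    ... | no ¬aug = begin
      augment j u S * (1ℚ - collisionsʳ j u S - collisionsˡ j u S)
        ≡⟨ cong (_* (1ℚ - collisionsʳ j u S - collisionsˡ j u S)) (augment≡0 {S} iso ¬aug) ⟩
      0ℚ * (1ℚ - collisionsʳ j u S - collisionsˡ j u S)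
        ≡⟨ *-zeroˡ (1ℚ - collisionsʳ j u S - collisionsˡ j u S) ⟩
      0ℚ
        ≤⟨ 0≤⟦ ⌊ P? ⌋ ⟧ ⟩
      ⟦ ⌊ P? ⌋ ⟧ ∎
      where open ≤-Reasoning
    ... | yes aug = subst (_≤ ⟦ ⌊ P? ⌋ ⟧)
      (sym (trans (cong (_* (1ℚ - collisionsʳ j u S - collisionsˡ j u S)) (augment≡1 {S} aug)) (*-identityˡ _)))
      (go P?)
      where
      go : (P? : Dec (Private S j u)) → 1ℚ - collisionsʳ j u S - collisionsˡ j u S ≤ ⟦ ⌊ P? ⌋ ⟧
      go (yes _) = 1-x-y≤1 0≤collisionsʳ 0≤collisionsˡ
      go (no ¬P) with FinP.any? (λ u′ → ¬? (u′ Fin.≟ u) ×-dec (lookup S (core j u′) Bool.≟ true))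
      ... | yes (u′ , u′≢u , Su′) = 1-x-y≤0ˡ (1≤collisionsʳ u′ u′≢u Su′) 0≤collisionsˡ
      ... | no ∄u with FinP.any? (λ j′ → ¬? (j′ Fin.≟ j) ×-dec augmenting? S j′ u)
      ...   | yes (j′ , j′≢j , aug′) = 1-x-y≤0ʳ 0≤collisionsʳ (1≤collisionsˡ j′ j′≢j aug′)
      ...   | no ∄j = contradiction
        (aug , (λ u′ u′≢u Su′ → ∄u (u′ , u′≢u , Su′)) , (λ j′ j′≢j aug′ → ∄j (j′ , j′≢j , aug′))) ¬P

  -- Counterpart of `row≤`. With a present leaf the core terms vanish and the selected leaf edge
  -- pays for the 1; without one, the core edges are compared through `privateLB≤`.
  greedy-row≥ : ∀ S j → (1ℚ - unmatched j S) + sum (λ u → privateLB j u S) ≤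
    sum (λ u → ⟦ lookup (greedy S) (core j u) ⟧) + sum (λ t → ⟦ lookup (greedy S) (leaf j t) ⟧)
  greedy-row≥ S j with true-or-allFalse (λ t → lookup S (leaf j t))
  ... | inj₁ (t , St) with s , first ← pick-complete (λ t → lookup S (leaf j t)) t St = begin
    (1ℚ - unmatched j S) + sum (λ u → privateLB j u S)
      ≡⟨ cong₂ (λ x y → (1ℚ - x) + y) matched (∑-zero (λ u → privateLB j u S) zeros) ⟩
    1ℚ
      ≡⟨ cong ⟦_⟧ (trans (lookup-leaf S j s) (⌊⌋-true (firstLeaf? S j s) first)) ⟨
    ⟦ lookup (greedy S) (leaf j s) ⟧
      ≤⟨ term≤∑ (λ t → ⟦ lookup (greedy S) (leaf j t) ⟧) (λ t → 0≤⟦ lookup (greedy S) (leaf j t) ⟧) s ⟩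
    sum (λ t → ⟦ lookup (greedy S) (leaf j t) ⟧)
      ≤⟨ ≤-witness _ (0≤-∑ _ (λ u → 0≤⟦ lookup (greedy S) (core j u) ⟧))
           (+-comm (sum (λ u → ⟦ lookup (greedy S) (core j u) ⟧)) _) ⟩
    sum (λ u → ⟦ lookup (greedy S) (core j u) ⟧) + sum (λ t → ⟦ lookup (greedy S) (leaf j t) ⟧) ∎
    where
    open ≤-Reasoning
    matched : unmatched j S ≡ 0ℚ
    matched = absent≡0 (leaf j) S t St
    zeros : ∀ u → privateLB j u S ≡ 0ℚ
    zeros u = trans (cong (λ x → X (core j u) S * x * (1ℚ - collisionsʳ j u S - collisionsˡ j u S)) matched)
      (solve 2 (λ x y → x :* con 0ℚ :* y := con 0ℚ) refl (X (core j u) S) (1ℚ - collisionsʳ j u S - collisionsˡ j u S))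
  ... | inj₂ isolated = begin
    (1ℚ - unmatched j S) + sum (λ u → privateLB j u S)
      ≡⟨ cong (λ x → (1ℚ - x) + sum (λ u → privateLB j u S)) (unmatched-isolated {S} {j} isolated) ⟩
    0ℚ + sum (λ u → privateLB j u S)
      ≡⟨ +-identityˡ _ ⟩
    sum (λ u → privateLB j u S)
      ≤⟨ ∑-mono _ _ (λ u → subst (λ b → privateLB j u S ≤ ⟦ b ⟧) (sym (lookup-core S j u))
           (privateLB≤ j u S isolated (private? S j u))) ⟩
    sum (λ u → ⟦ lookup (greedy S) (core j u) ⟧)
      ≤⟨ ≤-witness _ (0≤-∑ _ (λ t → 0≤⟦ lookup (greedy S) (leaf j t) ⟧)) refl ⟩
    sum (λ u → ⟦ lookup (greedy S) (core j u) ⟧) + sum (λ t → ⟦ lookup (greedy S) (leaf j t) ⟧) ∎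
    where open ≤-Reasoning

  μ≥ : ∀ S → sum (λ j → (1ℚ - unmatched j S) + sum (λ u → privateLB j u S)) ≤ ℕ→ℚ (μ G S)
  μ≥ S = begin
    sum (λ j → (1ℚ - unmatched j S) + sum (λ u → privateLB j u S))
      ≤⟨ ∑-mono _ _ (greedy-row≥ S) ⟩
    sum (λ j → sum (λ u → ⟦ lookup (greedy S) (core j u) ⟧) + sum (λ t → ⟦ lookup (greedy S) (leaf j t) ⟧))
      ≡⟨ ∑-edges (λ i → ⟦ lookup (greedy S) i ⟧) ⟨
    sum (λ i → ⟦ lookup (greedy S) i ⟧)
      ≡⟨ ∣-∣-∑ (greedy S) ⟨
    ℕ→ℚ ∣ greedy S ∣
      ≤⟨ ℕ→ℚ-mono (∣M∣≤μ G {greedy S} {S} (greedy⊆S S) (greedy-matching S)) ⟩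
    ℕ→ℚ (μ G S) ∎
    where open ≤-Reasoning

  -- Expectations on the hard graph

  row : Fin #edges → Fin n
  row i = proj₁ (remQuot {n} (k ℕ.+ d) i)

  row-core : ∀ j u → row (core j u) ≡ j
  row-core j u = cong proj₁ (FinP.remQuot-combine j (u ↑ˡ d))

  row-leaf : ∀ j t → row (leaf j t) ≡ j
  row-leaf j t = cong proj₁ (FinP.remQuot-combine j (k ↑ʳ t))

  unmatched-DependsOn-row : ∀ j → DependsOn (unmatched j) (λ i → row i ≡ j)
  unmatched-DependsOn-row j = DependsOn-⊆ {f = unmatched j} (λ { (t , refl) → row-leaf j t }) (absent-DependsOn (leaf j))

  -- All coins at v_j lie in row j, so usefulness at distinct left vertices is independent; this
  -- gives the square of p q in `E-augment*augment`.
  augment-DependsOn-row : ∀ j u → DependsOn (augment j u) (λ i → row i ≡ j)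
  augment-DependsOn-row j u = DependsOn-* {f = X (core j u)} {g = unmatched j}
    (DependsOn-⊆ {f = X (core j u)} (λ { refl → row-core j u }) (X-DependsOn (core j u)))
    (unmatched-DependsOn-row j)

  unmatched-avoids-core : ∀ j j′ u → DependsOn (unmatched j) (∁ (_≡ core j′ u))
  unmatched-avoids-core j j′ u = DependsOn-⊆ {f = unmatched j}
    (λ { (t , refl) eq → core≢leaf (sym eq) }) (absent-DependsOn (leaf j))

  module Expectation (p : ℚ) (0≤p : 0ℚ ≤ p) (p≤1 : p ≤ 1ℚ) where

    q : ℚ
    q = (1ℚ - p) ^ d

    0≤q : 0ℚ ≤ q
    0≤q = 0≤-^ d (p≤q⇒0≤q-p p≤1)

    E-unmatched : ∀ j → E p (unmatched j) ≡ q
    E-unmatched j = E-absent p (leaf j) (leaf-injectiveʳ j)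

    E-augment : ∀ j u → E p (augment j u) ≡ p * q
    E-augment j u = trans
      (E-independent p {f = X (core j u)} {g = unmatched j} (Fin._≟ core j u) (X-DependsOn (core j u)) (unmatched-avoids-core j j u))
      (cong₂ _*_ (E-X p (core j u)) (E-unmatched j))

    E-X*augment : ∀ j {u u′} → u′ ≢ u → E p (λ S → X (core j u′) S * augment j u S) ≡ p * (p * q)
    E-X*augment j {u} {u′} u′≢u = trans
      (E-independent p {f = X (core j u′)} {g = augment j u} (Fin._≟ core j u′) (X-DependsOn (core j u′))
        (DependsOn-* {f = X (core j u)} {g = unmatched j}
          (DependsOn-⊆ {f = X (core j u)} (λ { refl eq → u′≢u (sym (core-injectiveʳ j eq)) }) (X-DependsOn (core j u)))
          (unmatched-avoids-core j j u′)))
      (cong₂ _*_ (E-X p (core j u′)) (E-augment j u))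

    E-augment*augment : ∀ {j j′} u → j′ ≢ j → E p (λ S → augment j u S * augment j′ u S) ≡ (p * q) * (p * q)
    E-augment*augment {j} {j′} u j′≢j = trans
      (E-independent p {f = augment j u} {g = augment j′ u} (λ i → row i Fin.≟ j) (augment-DependsOn-row j u)
        (DependsOn-⊆ {f = augment j′ u} (λ row≡j′ row≡j → j′≢j (trans (sym row≡j′) row≡j)) (augment-DependsOn-row j′ u)))
      (cong₂ _*_ (E-augment j u) (E-augment j′ u))

    distinct*≤ : ∀ {m} (i j : Fin m) {x y} → 0ℚ ≤ y → (i ≢ j → x ≡ y) → distinct i j * x ≤ y
    distinct*≤ i j {x} {y} 0≤y x≡y with i Fin.≟ j
    ... | yes _  = subst (_≤ y) (sym (*-zeroˡ x)) 0≤y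
    ... | no i≢j = ≤-reflexive (trans (*-identityˡ x) (x≡y i≢j))

    -- This is p q (1 - k p - n p q): the probability of being useful minus bounds for the expected
    -- pairs with a rival at v_j and at u, the rivals being rounded up to k and n.
    privateBound : ℚ
    privateBound = p * q - ℕ→ℚ k * (p * (p * q)) - ℕ→ℚ n * ((p * q) * (p * q))

    privateLB-expand : ∀ j u S → privateLB j u S ≡
      augment j u S - sum (λ u′ → distinct u′ u * (X (core j u′) S * augment j u S))
                    - sum (λ j′ → distinct j′ j * (augment j u S * augment j′ u S))
    privateLB-expand j u S = begin
      A * (1ℚ - R - L)
        ≡⟨ solve 3 (λ a r l → a :* (con 1ℚ :- r :- l) := a :- a :* r :- a :* l) refl A R L ⟩
      A - A * R - A * L
        ≡⟨ cong₂ (λ x y → A - x - y)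
             (trans (*-distribˡ-sum A (λ u′ → distinct u′ u * X (core j u′) S))
               (sum-cong-≗ λ u′ → solve 3 (λ a b c → a :* (b :* c) := b :* (c :* a)) refl A (distinct u′ u) (X (core j u′) S)))
             (trans (*-distribˡ-sum A (λ j′ → distinct j′ j * augment j′ u S))
               (sum-cong-≗ λ j′ → solve 3 (λ a b c → a :* (b :* c) := b :* (a :* c)) refl A (distinct j′ j) (augment j′ u S))) ⟩
      A - sum (λ u′ → distinct u′ u * (X (core j u′) S * A)) - sum (λ j′ → distinct j′ j * (A * augment j′ u S)) ∎
      where
      open ≡-Reasoning
      A = augment j u S
      R = collisionsʳ j u S
      L = collisionsˡ j u S

    E-privateLB : ∀ j u → privateBound ≤ E p (privateLB j u)
    E-privateLB j u = begin
      p * q - ℕ→ℚ k * (p * (p * q)) - ℕ→ℚ n * ((p * q) * (p * q))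
        ≤⟨ +-mono-≤ (+-mono-≤ (≤-reflexive (sym (E-augment j u))) (neg-antimono-≤ R≤)) (neg-antimono-≤ L≤) ⟩
      E p (augment j u) - E p R - E p L
        ≡⟨ cong (_- E p L) (E-- p (augment j u) R) ⟨
      E p (λ S → augment j u S - R S) - E p L
        ≡⟨ E-- p (λ S → augment j u S - R S) L ⟨
      E p (λ S → augment j u S - R S - L S)
        ≡⟨ E-cong p (privateLB-expand j u) ⟨
      E p (privateLB j u) ∎
      where
      open ≤-Reasoning
      Rᵢ : Fin k → Subset #edges → ℚ
      Rᵢ u′ S = distinct u′ u * (X (core j u′) S * augment j u S)
      Lᵢ : Fin n → Subset #edges → ℚ
      Lᵢ j′ S = distinct j′ j * (augment j u S * augment j′ u S)
      R L : Subset #edges → ℚ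
      R S = sum (λ u′ → Rᵢ u′ S)
      L S = sum (λ j′ → Lᵢ j′ S)
      0≤pq : 0ℚ ≤ p * q
      0≤pq = 0≤-* 0≤p 0≤q
      R≤ : E p R ≤ ℕ→ℚ k * (p * (p * q))
      R≤ = begin
        E p R
          ≡⟨ E-∑ p Rᵢ ⟩
        sum (λ u′ → E p (Rᵢ u′))
          ≤⟨ ∑-mono _ _ (λ u′ → ≤-trans (≤-reflexive (E-scale p (distinct u′ u) (λ S → X (core j u′) S * augment j u S)))
               (distinct*≤ u′ u (0≤-* 0≤p 0≤pq) (E-X*augment j))) ⟩
        sum {k} (λ _ → p * (p * q))
          ≡⟨ ∑-const k (p * (p * q)) ⟩
        ℕ→ℚ k * (p * (p * q)) ∎
      L≤ : E p L ≤ ℕ→ℚ n * ((p * q) * (p * q))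
      L≤ = begin
        E p L
          ≡⟨ E-∑ p Lᵢ ⟩
        sum (λ j′ → E p (Lᵢ j′))
          ≤⟨ ∑-mono _ _ (λ j′ → ≤-trans (≤-reflexive (E-scale p (distinct j′ j) (λ S → augment j u S * augment j′ u S)))
               (distinct*≤ j′ j (0≤-* 0≤pq 0≤pq) (E-augment*augment u))) ⟩
        sum {n} (λ _ → (p * q) * (p * q))
          ≡⟨ ∑-const n ((p * q) * (p * q)) ⟩
        ℕ→ℚ n * ((p * q) * (p * q)) ∎

    E-1-unmatched : ∀ j → E p (λ S → 1ℚ - unmatched j S) ≡ 1ℚ - q
    E-1-unmatched j = trans (E-- p (λ _ → 1ℚ) (unmatched j)) (cong₂ _-_ (E-const p #edges 1ℚ) (E-unmatched j))

    -- Stated for a general f so that the lower bound for `μ` and the upper bound for the output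
    -- share the main term n (1 - q).
    E-rows : ∀ (f : Fin n → Fin k → Subset #edges → ℚ) →
      E p (λ S → sum (λ j → (1ℚ - unmatched j S) + sum (λ u → f j u S))) ≡
      ℕ→ℚ n * (1ℚ - q) + sum (λ j → sum (λ u → E p (f j u)))
    E-rows f = begin
      E p (λ S → sum (λ j → (1ℚ - unmatched j S) + sum (λ u → f j u S)))
        ≡⟨ E-∑ p (λ j S → (1ℚ - unmatched j S) + sum (λ u → f j u S)) ⟩
      sum (λ j → E p (λ S → (1ℚ - unmatched j S) + sum (λ u → f j u S)))
        ≡⟨ sum-cong-≗ (λ j → trans (E-+ p (λ S → 1ℚ - unmatched j S) (λ S → sum (λ u → f j u S)))
             (cong₂ _+_ (E-1-unmatched j) (E-∑ p (f j)))) ⟩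
      sum (λ j → (1ℚ - q) + sum (λ u → E p (f j u)))
        ≡⟨ ∑-distrib-+ {n} (λ _ → 1ℚ - q) (λ j → sum (λ u → E p (f j u))) ⟩
      sum {n} (λ _ → 1ℚ - q) + sum (λ j → sum (λ u → E p (f j u)))
        ≡⟨ cong (_+ sum (λ j → sum (λ u → E p (f j u)))) (∑-const n (1ℚ - q)) ⟩
      ℕ→ℚ n * (1ℚ - q) + sum (λ j → sum (λ u → E p (f j u))) ∎
      where open ≡-Reasoning

    E-μ≥ : ℕ→ℚ n * (1ℚ - q) + ℕ→ℚ n * (ℕ→ℚ k * privateBound) ≤ 𝔼 p G (λ S → ℕ→ℚ (μ G S))
    E-μ≥ = begin
      ℕ→ℚ n * (1ℚ - q) + ℕ→ℚ n * (ℕ→ℚ k * privateBound)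
        ≡⟨ cong (ℕ→ℚ n * (1ℚ - q) +_) (trans (sum-cong-≗ {n} (λ _ → ∑-const k privateBound)) (∑-const n (ℕ→ℚ k * privateBound))) ⟨
      ℕ→ℚ n * (1ℚ - q) + sum {n} (λ _ → sum {k} (λ _ → privateBound))
        ≤⟨ +-monoʳ-≤ (ℕ→ℚ n * (1ℚ - q)) (∑-mono _ _ λ j → ∑-mono _ _ λ u → E-privateLB j u) ⟩
      ℕ→ℚ n * (1ℚ - q) + sum (λ j → sum (λ u → E p (privateLB j u)))
        ≡⟨ E-rows privateLB ⟨
      E p (λ S → sum (λ j → (1ℚ - unmatched j S) + sum (λ u → privateLB j u S)))
        ≤⟨ E-mono 0≤p p≤1 μ≥ ⟩
      E p (λ S → ℕ→ℚ (μ G S))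
        ≡⟨ 𝔼≡E p G (λ S → ℕ→ℚ (μ G S)) ⟨
      𝔼 p G (λ S → ℕ→ℚ (μ G S)) ∎
      where open ≤-Reasoning

    E-output≤ : ∀ (A : Algorithm G) →
      𝔼 p G (λ S → ℕ→ℚ ∣ output A (query A ∩ S) ∣) ≤
      ℕ→ℚ n * (1ℚ - q) + ℕ→ℚ k * (ℕ→ℚ (maxDeg G (query A)) * (p * q))
    E-output≤ A = begin
      𝔼 p G (λ S → ℕ→ℚ ∣ output A (Q ∩ S) ∣)
        ≡⟨ 𝔼≡E p G (λ S → ℕ→ℚ ∣ output A (Q ∩ S) ∣) ⟩
      E p (λ S → ℕ→ℚ ∣ output A (Q ∩ S) ∣)
        ≤⟨ E-mono 0≤p p≤1 (λ S → matching-size≤ {Q} {S} {output A (Q ∩ S)} (sound A S) (matching A S)) ⟩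
      E p (λ S → sum (λ j → (1ℚ - unmatched j S) + sum (λ u → ⟦ lookup Q (core j u) ⟧ * augment j u S)))
        ≡⟨ E-rows (λ j u S → ⟦ lookup Q (core j u) ⟧ * augment j u S) ⟩
      ℕ→ℚ n * (1ℚ - q) + sum (λ j → sum (λ u → E p (λ S → ⟦ lookup Q (core j u) ⟧ * augment j u S)))
        -- Non-adaptivity enters here: Q is fixed before S is drawn, so its indicator leaves the
        -- expectation as a constant.
        ≡⟨ cong (ℕ→ℚ n * (1ℚ - q) +_) (sum-cong-≗ λ j → sum-cong-≗ λ u →
             trans (E-scale p ⟦ lookup Q (core j u) ⟧ (augment j u)) (cong (⟦ lookup Q (core j u) ⟧ *_) (E-augment j u))) ⟩
      ℕ→ℚ n * (1ℚ - q) + sum (λ j → sum (λ u → ⟦ lookup Q (core j u) ⟧ * (p * q)))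
        -- With u outermost the inner sum counts the core edges of Q at u, hence `maxDeg` bounds it.
        ≡⟨ cong (ℕ→ℚ n * (1ℚ - q) +_) (∑-comm (λ j u → ⟦ lookup Q (core j u) ⟧ * (p * q))) ⟩
      ℕ→ℚ n * (1ℚ - q) + sum (λ u → sum (λ j → ⟦ lookup Q (core j u) ⟧ * (p * q)))
        ≤⟨ +-monoʳ-≤ (ℕ→ℚ n * (1ℚ - q)) (∑-mono _ _ λ u → ≤-trans
             (≤-reflexive (sym (*-distribʳ-sum (p * q) (λ j → ⟦ lookup Q (core j u) ⟧))))
             (*-monoʳ-≤ (0≤-* 0≤p 0≤q) (∑-core≤maxDeg Q u))) ⟩
      ℕ→ℚ n * (1ℚ - q) + sum {k} (λ _ → ℕ→ℚ (maxDeg G Q) * (p * q))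
        ≡⟨ cong (ℕ→ℚ n * (1ℚ - q) +_) (∑-const k (ℕ→ℚ (maxDeg G Q) * (p * q))) ⟩
      ℕ→ℚ n * (1ℚ - q) + ℕ→ℚ k * (ℕ→ℚ (maxDeg G Q) * (p * q)) ∎
      where
      open ≤-Reasoning
      Q = query A

-- Choice of the parameters

-- A discrete intermediate value principle, by descent from N to the first failure.
crossing : ∀ {P : ℕ → Set} → (∀ i → Dec (P i)) → ∀ N → ¬ P 0 → P N → ∃ λ i → ¬ P i × P (suc i)
crossing P? zero    ¬P0 PN = contradiction PN ¬P0
crossing P? (suc N) ¬P0 PN with P? N
... | yes P = crossing P? N ¬P0 P
... | no ¬P = N , ¬P , PN

-- The denominator of r serves as N, since the numerator of a positive rational is at least 1.
archimedean : ∀ r → 0ℚ < r → ∃ λ N → 1ℚ ≤ ℕ→ℚ N * r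
archimedean (mkℚ (ℤ.+ zero)   d _) (*<* (ℤ.+<+ ()))
archimedean (mkℚ (ℤ.-[1+ n ]) d _) (*<* ())
archimedean r@(mkℚ (ℤ.+ suc n) d _) 0<r = suc d , toℚᵘ-cancel-≤ (begin
  ℚᵘ.1ℚᵘ
    ≤⟨ ℚᵘ.*≤* (ℤ.+≤+ 1*d≤) ⟩
  ℚᵘ.mkℚᵘ (ℤ.+ suc d) 0 ℚᵘ.* ℚᵘ.mkℚᵘ (ℤ.+ suc n) d
    ≃⟨ ℚᵘP.*-congʳ {ℚᵘ.mkℚᵘ (ℤ.+ suc n) d} (toℚᵘ-fromℚᵘ (ℚᵘ.mkℚᵘ (ℤ.+ suc d) 0)) ⟨
  toℚᵘ (ℕ→ℚ (suc d)) ℚᵘ.* toℚᵘ r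
    ≃⟨ toℚᵘ-homo-* (ℕ→ℚ (suc d)) r ⟨
  toℚᵘ (ℕ→ℚ (suc d) * r) ∎)
  where
  open ℚᵘP.≤-Reasoning
  1*d≤ : 1 ℕ.* (1 ℕ.* suc d) ℕ.≤ suc d ℕ.* suc n ℕ.* 1
  1*d≤ = subst₂ ℕ._≤_ (sym (trans (ℕP.*-identityˡ _) (ℕP.*-identityˡ _))) (sym (ℕP.*-identityʳ _)) (ℕP.m≤m*n (suc d) (suc n))

⅛ ¼ : ℚ
⅛ = ℤ.+ 1 / 8
¼ = ℤ.+ 1 / 4

-- Multiples of r advance by at most 1/8, so the one that crosses 1/8 has not passed 1/4.
multiple-near-⅛ : ∀ r → 0ℚ < r → r ≤ ⅛ → ∃ λ k → ⅛ ≤ ℕ→ℚ k * r × ℕ→ℚ k * r ≤ ¼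
multiple-near-⅛ r 0<r r≤⅛
  with N , 1≤Nr ← archimedean r 0<r
  with k , ¬P , P ← crossing (λ k → ⅛ ℚP.≤? ℕ→ℚ k * r) N
         (λ ⅛≤0 → contradiction (subst (⅛ ≤_) (*-zeroˡ r) ⅛≤0) (from-no (⅛ ℚP.≤? 0ℚ)))
         (≤-trans (from-yes (⅛ ℚP.≤? 1ℚ)) 1≤Nr)
  = suc k , P , (begin
    ℕ→ℚ (suc k) * r     ≡⟨ cong (_* r) (ℕ→ℚ-suc k) ⟩
    (1ℚ + ℕ→ℚ k) * r    ≡⟨ solve 2 (λ k r → (con 1ℚ :+ k) :* r := r :+ k :* r) refl (ℕ→ℚ k) r ⟩
    r + ℕ→ℚ k * r       ≤⟨ +-mono-≤ r≤⅛ (<⇒≤ (≰⇒> ¬P)) ⟩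
    ⅛ + ⅛               ≡⟨⟩
    ¼                   ∎)
  where open ≤-Reasoning

-- A division-free form of (1 - p)^N ≤ 1 / (1 + N p). In the induction step (1 - p) (1 + (N + 1) p)
-- falls short of 1 + N p by p (p + N p), which is the witness up to the factor x.
bernoulli : ∀ {p} → 0ℚ ≤ p → p ≤ 1ℚ → ∀ N → (1ℚ - p) ^ N * (1ℚ + ℕ→ℚ N * p) ≤ 1ℚ
bernoulli {p} 0≤p p≤1 zero = ≤-reflexive (solve 1 (λ p → con 1ℚ :* (con 1ℚ :+ con 0ℚ :* p) := con 1ℚ) refl p)
bernoulli {p} 0≤p p≤1 (suc N) = ≤-trans
  (≤-witness (x * (p * (p + n * p)))
    (0≤-* (0≤-^ N (p≤q⇒0≤q-p p≤1)) (0≤-* 0≤p (0≤-+ 0≤p (0≤-* (0≤ℕ→ℚ N) 0≤p))))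
    (trans (solve 3 (λ p x n → x :* (con 1ℚ :+ n :* p) :=
        (con 1ℚ :- p) :* x :* (con 1ℚ :+ (con 1ℚ :+ n) :* p) :+ x :* (p :* (p :+ n :* p))) refl p x n)
      (cong (λ y → (1ℚ - p) * x * (1ℚ + y * p) + x * (p * (p + n * p))) (sym (ℕ→ℚ-suc N)))))
  (bernoulli 0≤p p≤1 N)
  where
  x = (1ℚ - p) ^ N
  n = ℕ→ℚ N

-- Take N with N p δ ≥ 1. A power above δ would make the product in `bernoulli` at least δ (1 + N p)
-- ≥ δ + 1 > 1.
power-below : ∀ {p δ} → 0ℚ < p → p ≤ 1ℚ → 0ℚ < δ → ∃ λ N → (1ℚ - p) ^ N ≤ δ
power-below {p} {δ} 0<p p≤1 0<δ with N , 1≤Npδ ← archimedean (p * δ) (0<-* 0<p 0<δ) = N , ≮⇒≥ λ δ<x →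
  <-irrefl refl (begin-strict
    1ℚ                                   <⟨ +-mono-<-≤ 0<δ 1≤Npδ ⟩
    δ + ℕ→ℚ N * (p * δ)                  ≡⟨ solve 3 (λ d n p → d :+ n :* (p :* d) := d :* (con 1ℚ :+ n :* p)) refl δ (ℕ→ℚ N) p ⟩
    δ * (1ℚ + ℕ→ℚ N * p)                 ≤⟨ *-monoʳ-≤ (0≤-+ 0≤1 (0≤-* (0≤ℕ→ℚ N) (<⇒≤ 0<p))) (<⇒≤ δ<x) ⟩
    (1ℚ - p) ^ N * (1ℚ + ℕ→ℚ N * p)      ≤⟨ bernoulli (<⇒≤ 0<p) p≤1 N ⟩
    1ℚ                                   ∎)
  where open ≤-Reasoning

2ℚ : ℚ
2ℚ = 1ℚ + 1ℚ

2p≤1⇒p≤1 : ∀ {p} → 0ℚ ≤ p → 2ℚ * p ≤ 1ℚ → p ≤ 1ℚ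
2p≤1⇒p≤1 {p} 0≤p = ≤-trans
  (≤-witness p 0≤p (solve 1 (λ p → (con 1ℚ :+ con 1ℚ) :* p := p :+ p) refl p))

halving : ∀ {p x} → 2ℚ * p ≤ 1ℚ → 0ℚ ≤ x → x ≤ 2ℚ * ((1ℚ - p) * x)
halving {p} {x} 2p≤1 0≤x = ≤-witness ((1ℚ - 2ℚ * p) * x) (0≤-* (p≤q⇒0≤q-p 2p≤1) 0≤x)
  (solve 2 (λ p x → (con 1ℚ :+ con 1ℚ) :* ((con 1ℚ :- p) :* x) :=
    x :+ (con 1ℚ :- (con 1ℚ :+ con 1ℚ) :* p) :* x) refl p x)

-- Since 1 - p ≥ 1/2, each further factor at most halves the power, so the power that crosses δ is
-- still at least δ / 2.
power-near : ∀ {p δ} → 0ℚ < p → 2ℚ * p ≤ 1ℚ → 0ℚ < δ → δ ≤ 1ℚ →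
  ∃ λ d → (1ℚ - p) ^ d ≤ δ × δ ≤ 2ℚ * (1ℚ - p) ^ d
power-near {p} {δ} 0<p 2p≤1 0<δ δ≤1 = go (1ℚ ℚP.≤? δ)
  where
  p≤1 : p ≤ 1ℚ
  p≤1 = 2p≤1⇒p≤1 (<⇒≤ 0<p) 2p≤1
  go : Dec (1ℚ ≤ δ) → ∃ λ d → (1ℚ - p) ^ d ≤ δ × δ ≤ 2ℚ * (1ℚ - p) ^ d
  -- For δ = 1 there is nothing to cross, as the exponent 0 already qualifies.
  go (yes 1≤δ) = 0 , 1≤δ , ≤-trans δ≤1 (≤-witness 1ℚ 0≤1 refl)
  go (no 1≰δ) =
    let N , P = power-below 0<p p≤1 0<δ
        d , ¬P , P′ = crossing {P = λ d → (1ℚ - p) ^ d ≤ δ} (λ d → (1ℚ - p) ^ d ℚP.≤? δ) N 1≰δ P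
    in suc d , P′ , ≤-trans (<⇒≤ (≰⇒> ¬P)) (halving {p} 2p≤1 (0≤-^ d (p≤q⇒0≤q-p p≤1)))

-- From the expectation bounds to the degree bound

8ℚ 32ℚ 64ℚ 16ℚ 2048ℚ : ℚ
8ℚ = ℤ.+ 8 / 1
32ℚ = ℤ.+ 32 / 1
64ℚ = ℤ.+ 64 / 1
16ℚ = ℤ.+ 16 / 1
2048ℚ = ℤ.+ 2048 / 1

module Arithmetic {ε p q n k D : ℚ} (0<ε : 0ℚ < ε) (0<p : 0ℚ < p) (0≤q : 0ℚ ≤ q)
  (0≤n : 0ℚ ≤ n) (0≤k : 0ℚ ≤ k) (0≤D : 0ℚ ≤ D)
  (32ε≤q : 32ℚ * ε ≤ q) (q≤64ε : q ≤ 64ℚ * ε)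
  (⅛≤kp : ⅛ ≤ k * p) (kp≤¼ : k * p ≤ ¼)
  (⅛≤npq : ⅛ ≤ n * (p * q)) (npq≤¼ : n * (p * q) ≤ ¼)
  (approx : (1ℚ - ε) * (n * (1ℚ - q) + n * (k * (p * q - k * (p * (p * q)) - n * ((p * q) * (p * q))))) ≤
            n * (1ℚ - q) + k * (D * (p * q)))
  where

  0≤ε : 0ℚ ≤ ε
  0≤ε = <⇒≤ 0<ε

  0≤p : 0ℚ ≤ p
  0≤p = <⇒≤ 0<p

  0≤kp : 0ℚ ≤ k * p
  0≤kp = 0≤-* 0≤k 0≤p

  0<kp : 0ℚ < k * p
  0<kp = <-≤-trans (from-yes (0ℚ ℚP.<? ⅛)) ⅛≤kp

  0≤npq : 0ℚ ≤ n * (p * q)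
  0≤npq = 0≤-* 0≤n (0≤-* 0≤p 0≤q)

  slack : 0ℚ ≤ 1ℚ - (k * p + k * p + (n * (p * q) + n * (p * q)))
  slack = p≤q⇒0≤q-p (+-mono-≤ (+-mono-≤ kp≤¼ kp≤¼) (+-mono-≤ npq≤¼ npq≤¼))

  1-kp : 0ℚ ≤ 1ℚ - k * p
  1-kp = p≤q⇒0≤q-p (≤-trans kp≤¼ (from-yes (¼ ℚP.≤? 1ℚ)))

  -- The three summands of the witness are the slacks of the hypothesis approx,
  -- of the bound by n of its lower bound for E μ, and of k p + n p q ≤ 1/2.
  core-bound : n * (k * (p * q)) ≤ 2ℚ * (ε * n + k * (D * (p * q)))
  core-bound = ≤-witness
    ( 2ℚ * (n * (1ℚ - q) + k * (D * (p * q))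
        - (1ℚ - ε) * (n * (1ℚ - q) + n * (k * (p * q - k * (p * (p * q)) - n * ((p * q) * (p * q))))))
    + 2ℚ * (ε * (n * q * (1ℚ - k * p + k * p * (k * p + n * (p * q)))))
    + n * (k * (p * q)) * (1ℚ - (k * p + k * p + (n * (p * q) + n * (p * q)))) )
    (0≤-+ (0≤-+
      (0≤-* 0≤2 (p≤q⇒0≤q-p approx))
      (0≤-* 0≤2 (0≤-* 0≤ε (0≤-* (0≤-* 0≤n 0≤q) (0≤-+ 1-kp (0≤-* 0≤kp (0≤-+ 0≤kp 0≤npq)))))))
      (0≤-* (0≤-* 0≤n (0≤-* 0≤k (0≤-* 0≤p 0≤q))) slack))
    (solve 6 (λ ε p q n k D → let two = con 1ℚ :+ con 1ℚ in
      two :* (ε :* n :+ k :* (D :* (p :* q))) :=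
      n :* (k :* (p :* q)) :+
      ( two :* (n :* (con 1ℚ :- q) :+ k :* (D :* (p :* q))
          :- (con 1ℚ :- ε) :* (n :* (con 1ℚ :- q) :+ n :* (k :* (p :* q :- k :* (p :* (p :* q)) :- n :* ((p :* q) :* (p :* q))))))
      :+ two :* (ε :* (n :* q :* (con 1ℚ :- k :* p :+ k :* p :* (k :* p :+ n :* (p :* q)))))
      :+ n :* (k :* (p :* q)) :* (con 1ℚ :- (k :* p :+ k :* p :+ (n :* (p :* q) :+ n :* (p :* q))))))
      refl ε p q n k D)
    where
    0≤2 : 0ℚ ≤ 2ℚ
    0≤2 = from-yes (0ℚ ℚP.≤? 2ℚ)

  -- The factor ε k p is kept on both sides until positivity lets us cancel it.
  scaled : ε * (k * p) * (8ℚ * (n * (p * q))) ≤ ε * (k * p) * (2048ℚ * (ε * p * D))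
  scaled = ≤-witness
    -- The weights are fixed by cancellation: 16 against 1 removes ε² n p, 16 · 2 against 32 removes
    -- the term in D q, and 8 against 1 removes ε n p q, which leaves 16 - 8 = 8 copies of ε k n p²
    -- q.
    ( 16ℚ * (ε * p * (2ℚ * (ε * n + k * (D * (p * q))) - n * (k * (p * q))))
    + ε * (n * p) * (q - 32ℚ * ε)
    + 32ℚ * (ε * p * D * (k * p) * (64ℚ * ε - q))
    + 8ℚ * (ε * (n * (p * q)) * (k * p - ⅛)) )
    (0≤-+ (0≤-+ (0≤-+
      (0≤-* (from-yes (0ℚ ℚP.≤? 16ℚ)) (0≤-* (0≤-* 0≤ε 0≤p) (p≤q⇒0≤q-p core-bound)))
      (0≤-* (0≤-* 0≤ε (0≤-* 0≤n 0≤p)) (p≤q⇒0≤q-p 32ε≤q)))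
      (0≤-* (from-yes (0ℚ ℚP.≤? 32ℚ)) (0≤-* (0≤-* (0≤-* (0≤-* 0≤ε 0≤p) 0≤D) 0≤kp) (p≤q⇒0≤q-p q≤64ε))))
      (0≤-* (from-yes (0ℚ ℚP.≤? 8ℚ)) (0≤-* (0≤-* 0≤ε 0≤npq) (p≤q⇒0≤q-p ⅛≤kp))))
    (solve 6 (λ ε p q n k D →
      ε :* (k :* p) :* (con 2048ℚ :* (ε :* p :* D)) :=
      ε :* (k :* p) :* (con 8ℚ :* (n :* (p :* q))) :+
      ( con 16ℚ :* (ε :* p :* (con 2ℚ :* (ε :* n :+ k :* (D :* (p :* q))) :- n :* (k :* (p :* q))))
      :+ ε :* (n :* p) :* (q :- con 32ℚ :* ε)
      :+ con 32ℚ :* (ε :* p :* D :* (k :* p) :* (con 64ℚ :* ε :- q))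
      :+ con 8ℚ :* (ε :* (n :* (p :* q)) :* (k :* p :- con ⅛)) ))
      refl ε p q n k D)

  -- 2048 = 4 · 8 · 64: the degree is at least n / 4, n p q is at least 1/8, and q is at most 64 ε.
  conclusion : ℤ.+ 1 / 2048 ≤ ε * p * D
  conclusion = *-cancelˡ-≤-pos 2048ℚ (≤-trans (*-monoˡ-≤ (from-yes (0ℚ ℚP.≤? 8ℚ)) ⅛≤npq)
    (*-cancelˡ-≤-pos (ε * (k * p)) {{positive (0<-* 0<ε 0<kp)}} scaled))

1/64 1/2048 : ℚ
1/64 = ℤ.+ 1 / 64
1/2048 = ℤ.+ 1 / 2048

-- The bound ε ≤ 1/64 makes 64 ε a legitimate target for a power of 1 - p, while p ≤ 1/8 limits the
-- step size of the multiples of p and p q and gives the p ≤ 1/2 of the halving argument.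
hard-instance : ∀ {p ε} → 0ℚ < p → p ≤ ⅛ → 0ℚ < ε → ε ≤ 1/64 →
  Σ BipGraph λ G → ∀ (A : Algorithm G) → Approx p ε G A →
    1/2048 ≤ ε * p * ℕ→ℚ (maxDeg G (query A))
hard-instance {p} {ε} 0<p p≤⅛ 0<ε ε≤1/64 = choose-d (power-near 0<p 2p≤1 0<64ε 64ε≤1)
  where
  2p≤1 : 2ℚ * p ≤ 1ℚ
  2p≤1 = ≤-trans (*-monoˡ-≤ (from-yes (0ℚ ℚP.≤? 2ℚ)) p≤⅛) (from-yes (2ℚ * ⅛ ℚP.≤? 1ℚ))

  0≤p : 0ℚ ≤ p
  0≤p = <⇒≤ 0<p

  p≤1 : p ≤ 1ℚ
  p≤1 = 2p≤1⇒p≤1 0≤p 2p≤1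

  64ε≤1 : 64ℚ * ε ≤ 1ℚ
  64ε≤1 = *-monoˡ-≤ (from-yes (0ℚ ℚP.≤? 64ℚ)) ε≤1/64

  0<64ε : 0ℚ < 64ℚ * ε
  0<64ε = 0<-* (from-yes (0ℚ ℚP.<? 64ℚ)) 0<ε

  0≤1-ε : 0ℚ ≤ 1ℚ - ε
  0≤1-ε = p≤q⇒0≤q-p (≤-trans ε≤1/64 (from-yes (1/64 ℚP.≤? 1ℚ)))

  Goal : Set
  Goal = Σ BipGraph λ G → ∀ (A : Algorithm G) → Approx p ε G A →
    1/2048 ≤ ε * p * ℕ→ℚ (maxDeg G (query A))

  choose-d : (∃ λ d → (1ℚ - p) ^ d ≤ 64ℚ * ε × 64ℚ * ε ≤ 2ℚ * (1ℚ - p) ^ d) → Goal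
  choose-d (d , q≤64ε , 64ε≤2q) =
    choose-k-n (multiple-near-⅛ p 0<p p≤⅛) (multiple-near-⅛ (p * q) (0<-* 0<p 0<q) pq≤⅛)
    where
    q : ℚ
    q = (1ℚ - p) ^ d

    32ε≤q : 32ℚ * ε ≤ q
    32ε≤q = *-cancelˡ-≤-pos 2ℚ (subst (_≤ 2ℚ * q) (*-assoc 2ℚ 32ℚ ε) 64ε≤2q)

    0<q : 0ℚ < q
    0<q = <-≤-trans (0<-* (from-yes (0ℚ ℚP.<? 32ℚ)) 0<ε) 32ε≤q

    pq≤⅛ : p * q ≤ ⅛
    pq≤⅛ = ≤-trans (*-monoˡ-≤ 0≤p (≤-trans q≤64ε 64ε≤1)) (subst (_≤ ⅛) (sym (*-identityʳ p)) p≤⅛)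

    choose-k-n : (∃ λ k → ⅛ ≤ ℕ→ℚ k * p × ℕ→ℚ k * p ≤ ¼) →
      (∃ λ n → ⅛ ≤ ℕ→ℚ n * (p * q) × ℕ→ℚ n * (p * q) ≤ ¼) → Goal
    choose-k-n (k , ⅛≤kp , kp≤¼) (n , ⅛≤npq , npq≤¼) = G , λ A approx →
      Arithmetic.conclusion {ε} {p} {q} {ℕ→ℚ n} {ℕ→ℚ k} {ℕ→ℚ (maxDeg G (query A))}
        0<ε 0<p (<⇒≤ 0<q) (0≤ℕ→ℚ n) (0≤ℕ→ℚ k) (0≤ℕ→ℚ (maxDeg G (query A)))
        32ε≤q q≤64ε ⅛≤kp kp≤¼ ⅛≤npq npq≤¼
        (≤-trans (*-monoˡ-≤ 0≤1-ε E-μ≥) (≤-trans approx (E-output≤ A)))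
      where
      open HardGraph n k d
      open Expectation p 0≤p p≤1 using (E-μ≥; E-output≤)

theorem7p3 : Σ ℚ λ p₀ → Σ ℚ λ ε₀ → Σ ℚ λ c →
    (0ℚ < p₀) × (p₀ < 1ℚ) × (0ℚ < ε₀) × (ε₀ < 1ℚ) × (0ℚ < c) ×
    (∀ (p ε : ℚ) → 0ℚ < p → p ≤ p₀ → 0ℚ < ε → ε ≤ ε₀ →
    Σ BipGraph λ G →
    ∀ (A : Algorithm G) → Approx p ε G A →
    c ≤ ε * p * ℕ→ℚ (maxDeg G (query A)))
theorem7p3 = ⅛ , 1/64 , 1/2048 ,
  from-yes (0ℚ ℚP.<? ⅛) , from-yes (⅛ ℚP.<? 1ℚ) , from-yes (0ℚ ℚP.<? 1/64) , from-yes (1/64 ℚP.<? 1ℚ) ,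
  from-yes (0ℚ ℚP.<? 1/2048) , λ p ε 0<p p≤⅛ 0<ε ε≤1/64 → hard-instance 0<p p≤⅛ 0<ε ε≤1/64
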